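{- Let $G$ be a critical graph with $\chi(G) \geq \Delta(G) \geq 6$ and $\omega(\mathcal{H}(G)) \leq \left\lfloor \frac{\Delta(G)}{2} \right\rfloor - 2$. Then $G$ is the complete graph $K_{\chi(G)}$.
   Context: Graphs are finite and simple. $\chi(G)$, $\Delta(G)$, $\omega(G)$ denote the chromatic number, the maximum degree and the clique number of $G$ (the clique number of the graph with no vertices is $0$). A graph $G$ is critical if $\chi(G - v) < \chi(G)$ for every vertex $v$ of $G$. For a graph $G$, $\mathcal{H}(G)$ denotes the subgraph of $G$ induced on the vertices of degree at least $\chi(G)$. -}

module Defs where

open import Data.Fin using (Fin)
open import Data.Fin.Properties using (all?; any?) renaming (_≟_ to _≟ᶠ_)
open import Data.Fin.Subset using (Subset; _∈_; ∣_∣) renaming (⊥ to ∅)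
open import Data.Fin.Subset.Properties using (_∈?_; ∉⊥; ∣⊥∣≡0; ∣p∣≤n; anySubset?)
open import Data.List using (length; filter; map; allFin; upTo; lookup)
open import Data.List.Extrema.Nat using (min; max; min≤v⁺; argmin-all; argmax-all; v≤max⁺)
open import Data.List.Membership.Propositional using (lose)
open import Data.List.Membership.Propositional.Properties using (∈-filter⁺; ∈-upTo⁺)
open import Data.List.Relation.Unary.All.Properties using (all-filter)
open import Data.Nat using (ℕ; zero; suc; _≤_; _<_; _≟_; _≤?_; s≤s)
open import Data.Nat.Properties using (≤-refl; ≮⇒≥)
open import Data.Product using (∃; _×_; _,_)
open import Data.Sum using (inj₁; inj₂)
open import Data.Vec using (Vec; []; _∷_; tabulate) renaming (lookup to lookupᵛ)
open import Data.Vec.Properties using (lookup∘tabulate)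
open import Function using (_∘_; id; _↔_; _⇔_; Inverse)
open import Level using (Level; 0ℓ)
open import Relation.Binary using (Rel; Symmetric; Irreflexive) renaming (Decidable to Decidable₂)
open import Relation.Binary.PropositionalEquality using (_≡_; _≢_; refl; sym; trans; subst; ≢-sym)
open import Relation.Nullary using (Dec; yes; no; ¬?; contradiction)
open import Relation.Nullary.Decidable using (map′; _×-dec_; _→-dec_)
open import Relation.Unary using (Pred; Decidable)

private
  variable
    m n : ℕ
    ℓ : Level

record Graph (n : ℕ) : Set₁ where
  infix 4 _~_ _~?_
  field
    _~_    : Rel (Fin n) 0ℓ
    ~-sym  : Symmetric _~_
    ~-irr  : Irreflexive _≡_ _~_
    _~?_   : Decidable₂ _~_

open Graph using (~-sym; ~-irr) public

K : (n : ℕ) → Graph n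
K n = record
  { _~_   = _≢_
  ; ~-sym = ≢-sym
  ; ~-irr = λ x≡y x≢y → x≢y x≡y
  ; _~?_  = λ x y → ¬? (x ≟ᶠ y)
  }

infix 4 _≅_

record _≅_ (G : Graph m) (H : Graph n) : Set where
  private
    module G = Graph G
    module H = Graph H
  field
    bijection : Fin m ↔ Fin n
  open Inverse bijection using (to)
  field
    preserves-~ : ∀ u v → u G.~ v ⇔ to u H.~ to v

-- The vertices satisfying P are renumbered in increasing order.
induced : (G : Graph n) {P : Pred (Fin n) ℓ} (P? : Decidable P) →
          Graph (length (filter P? (allFin n)))
induced {n} G P? = record
  { _~_   = λ i j → vertex i ~ vertex j
  ; ~-sym = ~-sym G
  ; ~-irr = λ { refl → ~-irr G refl }
  ; _~?_  = λ i j → vertex i ~? vertex j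
  }
  where
  open Graph G
  vertex = lookup (filter P? (allFin n))

infixl 6 _-_

_-_ : (G : Graph n) (v : Fin n) → Graph (length (filter (λ w → ¬? (w ≟ᶠ v)) (allFin n)))
G - v = induced G (λ w → ¬? (w ≟ᶠ v))

degree : Graph n → Fin n → ℕ
degree {n} G v = length (filter (v ~?_) (allFin n))
  where open Graph G

Δ : Graph n → ℕ
Δ {n} G = max 0 (map (degree G) (allFin n))

Proper : Graph n → ∀ {k} → (Fin n → Fin k) → Set
Proper G c = ∀ u v → u ~ v → c u ≢ c v
  where open Graph G

Colourable : Graph n → ℕ → Set
Colourable {n} G k = ∃ λ (c : Fin n → Fin k) → Proper G c

proper? : (G : Graph n) → ∀ {k} → Decidable (Proper G {k})
proper? G c = all? λ u → all? λ v → (u ~? v) →-dec ¬? (c u ≟ᶠ c v)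
  where open Graph G

anyVec? : ∀ {k} {P : Pred (Vec (Fin k) n) ℓ} → Decidable P → Dec (∃ P)
anyVec? {n = zero} P? =
  map′ (λ p → [] , p) (λ { ([] , p) → p }) (P? [])
anyVec? {n = suc n} P? =
  map′ (λ { (x , xs , p) → x ∷ xs , p }) (λ { (x ∷ xs , p) → x , xs , p })
       (any? λ x → anyVec? (P? ∘ (x ∷_)))

colourable? : (G : Graph n) → Decidable (Colourable G)
colourable? G k =
  map′ (λ (xs , p) → lookupᵛ xs , p)
       (λ (c , p) → tabulate c , λ u v u~v eq →
         p u v u~v (trans (sym (lookup∘tabulate c u)) (trans eq (lookup∘tabulate c v))))
       (anyVec? (proper? G ∘ lookupᵛ))

-- A graph on n vertices is n-colourable, so k < n and the default n
-- cover every possible value of the chromatic number.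
χ : Graph n → ℕ
χ {n} G = min n (filter (colourable? G) (upTo n))

χ-colourable : (G : Graph n) → Colourable G (χ G)
χ-colourable {n} G =
  argmin-all id (id , λ u v u~v u≡v → ~-irr G u≡v u~v)
                (all-filter (colourable? G) (upTo n))

χ-minimal : (G : Graph n) → ∀ {k} → Colourable G k → χ G ≤ k
χ-minimal {n} G {k} col with suc k ≤? n
... | yes k<n = min≤v⁺ n (filter (colourable? G) (upTo n))
        (inj₂ (lose (∈-filter⁺ (colourable? G) (∈-upTo⁺ k<n) col) ≤-refl))
... | no k≮n = min≤v⁺ n (filter (colourable? G) (upTo n)) (inj₁ (≮⇒≥ k≮n))

IsClique : Graph n → Subset n → Set
IsClique G S = ∀ u v → u ∈ S → v ∈ S → u ≢ v → u ~ v
  where open Graph G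

HasClique : Graph n → ℕ → Set
HasClique {n} G k = ∃ λ (S : Subset n) → IsClique G S × ∣ S ∣ ≡ k

isClique? : (G : Graph n) → Decidable (IsClique G)
isClique? G S = all? λ u → all? λ v →
  (u ∈? S) →-dec ((v ∈? S) →-dec (¬? (u ≟ᶠ v) →-dec (u ~? v)))
  where open Graph G

hasClique? : (G : Graph n) → Decidable (HasClique G)
hasClique? G k = anySubset? λ S → isClique? G S ×-dec (∣ S ∣ ≟ k)

ω : Graph n → ℕ
ω {n} G = max 0 (filter (hasClique? G) (upTo (suc n)))

ω-attained : (G : Graph n) → HasClique G (ω G)
ω-attained {n} G =
  argmax-all id (∅ , (λ _ _ u∈∅ → contradiction u∈∅ ∉⊥) , ∣⊥∣≡0 n)
                (all-filter (hasClique? G) (upTo (suc n)))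

ω-maximal : (G : Graph n) → ∀ {k} → HasClique G k → k ≤ ω G
ω-maximal {n} G {k} clique@(S , _ , ∣S∣≡k) =
  v≤max⁺ 0 (filter (hasClique? G) (upTo (suc n)))
    (inj₂ (lose (∈-filter⁺ (hasClique? G)
                  (∈-upTo⁺ (s≤s (subst (_≤ n) ∣S∣≡k (∣p∣≤n S)))) clique) ≤-refl))

Critical : Graph n → Set
Critical G = ∀ v → χ (G - v) < χ G

ℋ : (G : Graph n) → Graph (length (filter (λ v → χ G ≤? degree G v) (allFin n)))
ℋ G = induced G (λ v → χ G ≤? degree G v)

-- Put k = χ(G) - 1: G is not k-colourable, but G minus a vertex is.  Split the k colours into two
-- sides.  For a partition σ of the vertices into two sides, a witness is a vertex whose deletion makes
-- each side colourable with its own colours.  Take σ with a witness and with as few edges inside the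
-- sides as possible (suitably weighted).  Then the witnesses of σ form a regular component of one side,
-- and a low witness (one of degree k) may be moved to the other side without losing minimality.
-- Moving low witnesses back and forth for ever, one must return to a component left earlier, and this
-- yields a fork: two low witnesses with a common low neighbour on the other side.  All low vertices in
-- the closed neighbourhood S of a fork vertex have closed neighbourhood S, and S has k + 1 elements.
--
-- If Δ(G) ≤ k, every vertex is low, so S is a clique: this is Brooks' theorem.  If Δ(G) = k + 1, Brooks'
-- theorem turns the components of witnesses into cliques, and since cliques of high vertices are small,
-- S has at least four low vertices.  If a and b in S were not adjacent, one of these low vertices, l,
-- would have a colour free at both, and giving it to a and b would leave a colour for everything else.

module Submission where

open import Defs
open import Data.Bool using (Bool; true; false; not; if_then_else_) renaming (_≟_ to _≟ᵇ_)
open import Data.Bool.Properties using (¬-not; not-¬; not-involutive)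
open import Data.Empty using (⊥; ⊥-elim)
open import Data.Fin using (Fin; zero; suc; punchIn; toℕ; fromℕ<; inject≤; splitAt; join; _↑ˡ_; _↑ʳ_)
open import Data.Fin.Permutation.Components using (transpose; transpose-inverse)
open import Data.Fin.Properties
  using (any?; all?; punchInᵢ≢i; suc-injective; pigeonhole; toℕ<n; toℕ-injective; toℕ-fromℕ<;
         ↑ˡ-injective; ↑ʳ-injective; splitAt-↑ˡ; splitAt-↑ʳ; join-splitAt; injective⇒≤; inject≤-injective)
  renaming (_≟_ to _≟ᶠ_)
open import Data.Fin.Subset using (Subset; _∈_; ∣_∣)
open import Data.Fin.Subset.Properties using (_∈?_; ⊆-antisym; ⊆⊤; ∣⊤∣≡n)
open import Data.List using (List; length; filter; map; tabulate; allFin; lookup; []; _∷_)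
open import Data.List.Extrema.Nat using (xs≤max)
open import Data.List.Membership.Propositional.Properties using (∈-filter⁺; ∈-allFin; ∈-lookup; ∈-map⁺)
open import Data.List.Relation.Unary.All using ([]; _∷_) renaming (lookup to lookupᴬ)
open import Data.List.Relation.Unary.All.Properties using (all-filter)
open import Data.List.Relation.Unary.Any using (index)
open import Data.List.Relation.Unary.Any.Properties using (lookup-index)
open import Data.List.Relation.Unary.Unique.Propositional using (Unique; []; _∷_)
open import Data.List.Relation.Unary.Unique.Propositional.Properties using (allFin⁺; filter⁺)
open import Data.Nat using (ℕ; zero; suc; _+_; _*_; _∸_; _≤_; _<_; _≤?_; _<?_; z≤n; s≤s; s≤s⁻¹; z<s; ⌊_/2⌋)
open import Data.Nat.Induction using (<-wellFounded)
open import Data.Nat.Properties hiding (_≟_; _≤?_; _<?_; ≡-irrelevant; suc-injective)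
open import Data.Nat.Solver using (module +-*-Solver)
open import Data.Product using (∃; ∃₂; _×_; _,_; proj₁; proj₂; uncurry)
open import Data.Sum using (_⊎_; inj₁; inj₂; [_,_]′)
open import Data.Unit using (⊤; tt)
open import Data.Vec using ([]; _∷_) renaming (lookup to lookupᵛ; tabulate to tabulateᵛ)
open import Data.Vec.Properties using (lookup∘tabulate; []=⇒lookup)
open import Function using (_∘_; id; mk⇔)
open import Function.Construct.Identity using (↔-id)
open import Function.Definitions using (Injective)
open import Induction.WellFounded using (Acc; acc)
open import Level using (0ℓ)
open import Relation.Binary.PropositionalEquality using (_≡_; _≢_; refl; sym; trans; cong; cong₂; subst; subst₂; ≢-sym; module ≡-Reasoning)
open import Relation.Nullary using (¬_; Dec; does; yes; no; ¬?; contradiction)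
open import Relation.Nullary.Decidable using (map′; _×-dec_; _⊎-dec_; _→-dec_; dec-true; dec-false; decidable-stable)
open import Relation.Unary using (Pred; Decidable)
open import Algebra.Properties.CommutativeMonoid.Sum +-0-commutativeMonoid using (sum; sum-remove; sum-cong-≗; ∑-distrib-+)

private
  variable
    n j : ℕ
    A : Set
    P Q : Pred (Fin n) 0ℓ
    u v w : Fin n

-- Counting the elements of a decidable subset of Fin n

bit : Bool → ℕ
bit b = if b then 1 else 0

# : Decidable P → ℕ
# P? = sum (λ i → bit (does (P? i)))

_∖_ : Pred (Fin n) 0ℓ → Fin n → Pred (Fin n) 0ℓ
(P ∖ x) u = P u × u ≢ x

_∖?_ : Decidable P → (x : Fin n) → Decidable (P ∖ x)
(P? ∖? x) u = P? u ×-dec ¬? (u ≟ᶠ x)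

does-cong : ∀ {A B : Set} (a : Dec A) (b : Dec B) → (A → B) → (B → A) → does a ≡ does b
does-cong (yes _) (yes _) _ _ = refl
does-cong (yes a) (no ¬b) f _ = contradiction (f a) ¬b
does-cong (no ¬a) (yes b) _ g = contradiction (g b) ¬a
does-cong (no _) (no _) _ _ = refl

#-mono : (P? : Decidable P) (Q? : Decidable Q) → (∀ u → P u → Q u) → # P? ≤ # Q?
#-mono {zero} P? Q? P⊆Q = z≤n
#-mono {suc n} P? Q? P⊆Q = +-mono-≤ (head (P? zero) (Q? zero)) (#-mono (P? ∘ suc) (Q? ∘ suc) (P⊆Q ∘ suc))
  where
  head : (p : Dec _) (q : Dec _) → bit (does p) ≤ bit (does q)
  head (no _)  _       = z≤n
  head (yes _) (yes _) = ≤-refl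
  head (yes p) (no ¬q) = contradiction (P⊆Q zero p) ¬q

#-cong : (P? : Decidable P) (Q? : Decidable Q) → (∀ u → P u → Q u) → (∀ u → Q u → P u) → # P? ≡ # Q?
#-cong P? Q? P⊆Q Q⊆P = ≤-antisym (#-mono P? Q? P⊆Q) (#-mono Q? P? Q⊆P)

#-remove : (P? : Decidable P) (x : Fin n) → P x → # P? ≡ suc (# (P? ∖? x))
#-remove {suc n} P? x Px = begin
  # P?                          ≡⟨ sum-remove {i = x} f ⟩
  f x + sum (f ∘ punchIn x)     ≡⟨ cong₂ _+_ (cong bit (dec-true (P? x) Px)) (sum-cong-≗ rest) ⟩
  suc (sum (g ∘ punchIn x))     ≡⟨ cong (λ b → suc (bit b + sum (g ∘ punchIn x))) (dec-false ((P? ∖? x) x) λ (_ , x≢x) → x≢x refl) ⟨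
  suc (g x + sum (g ∘ punchIn x)) ≡⟨ cong suc (sum-remove {i = x} g) ⟨
  suc (# (P? ∖? x))             ∎
  where
  open ≡-Reasoning
  f g : Fin (suc n) → ℕ
  f i = bit (does (P? i))
  g i = bit (does ((P? ∖? x) i))
  rest : ∀ j → f (punchIn x j) ≡ g (punchIn x j)
  rest j = cong bit (does-cong (P? _) ((P? ∖? x) _) (λ p → p , punchInᵢ≢i x j) proj₁)

#-remove-bit : (P? : Decidable P) (x : Fin n) → # P? ≡ bit (does (P? x)) + # (P? ∖? x)
#-remove-bit P? x with P? x in eq
... | yes Px = #-remove P? x Px
... | no ¬Px = #-cong P? (P? ∖? x) (λ u Pu → Pu , λ { refl → ¬Px Pu }) (λ _ → proj₁)

#-remove-≤ : (P? : Decidable P) (x : Fin n) → # P? ≤ suc (# (P? ∖? x))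
#-remove-≤ P? x with P? x
... | yes Px = ≤-reflexive (#-remove P? x Px)
... | no ¬Px = m≤n⇒m≤1+n (#-mono P? (P? ∖? x) λ u Pu → Pu , λ { refl → ¬Px Pu })

#-strict : (P? : Decidable P) (Q? : Decidable Q) → (∀ u → P u → Q u) → ∀ {x} → Q x → ¬ P x → # P? < # Q?
#-strict P? Q? P⊆Q {x} Qx ¬Px = subst (# P? <_) (sym (#-remove Q? x Qx))
  (s≤s (#-mono P? (Q? ∖? x) λ u Pu → P⊆Q u Pu , λ { refl → ¬Px Pu }))

#-tight : (P? : Decidable P) (Q? : Decidable Q) → (∀ u → P u → Q u) → # Q? ≤ # P? → ∀ u → Q u → P u
#-tight P? Q? P⊆Q Q≤P u Qu = decidable-stable (P? u) λ ¬Pu → <⇒≱ (#-strict P? Q? P⊆Q Qu ¬Pu) Q≤P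

#-split : (P? : Decidable P) (Q? : Decidable Q) →
          # P? ≡ # (λ u → P? u ×-dec Q? u) + # (λ u → P? u ×-dec ¬? (Q? u))
#-split P? Q? = trans (sum-cong-≗ λ u → pointwise (P? u) (Q? u)) (∑-distrib-+ (λ u → bit (does (P? u ×-dec Q? u))) _)
  where
  pointwise : ∀ {A B : Set} (a : Dec A) (b : Dec B) →
              bit (does a) ≡ bit (does (a ×-dec b)) + bit (does (a ×-dec ¬? b))
  pointwise (no _)  _       = refl
  pointwise (yes _) (yes _) = refl
  pointwise (yes _) (no _)  = refl

#-pick : (P? : Decidable P) → 1 ≤ # P? → ∃ P
#-pick {n} P? 1≤ with any? P?
... | yes p = p
... | no ¬p = contradiction (≤-trans 1≤ (empty P? λ u Pu → ¬p (u , Pu))) λ ()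
  where
  empty : ∀ {n} {P : Pred (Fin n) 0ℓ} (P? : Decidable P) → (∀ u → ¬ P u) → # P? ≤ 0
  empty {zero} P? ¬P = z≤n
  empty {suc n} P? ¬P rewrite dec-false (P? zero) (¬P zero) = empty (P? ∘ suc) (¬P ∘ suc)

#-pick≢ : (P? : Decidable P) → 2 ≤ # P? → ∀ x → ∃ λ u → P u × u ≢ x
#-pick≢ P? 2≤ x = #-pick (P? ∖? x) (s≤s⁻¹ (≤-trans 2≤ (#-remove-≤ P? x)))

#-image : (P? : Decidable P) (f : Fin j → Fin n) → Injective _≡_ _≡_ f → (∀ α → P (f α)) → j ≤ # P?
#-image {j = zero} P? f inj Pf = z≤n
#-image {j = suc j} P? f inj Pf = subst (suc j ≤_) (sym (#-remove P? (f zero) (Pf zero)))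
  (s≤s (#-image (P? ∖? f zero) (f ∘ suc) (suc-injective ∘ inj)
    λ α → Pf (suc α) , λ eq → contradiction (inj eq) λ ()))

#-cover : (P? : Decidable P) (c : Fin n → Fin j) → (∀ α → ∃ λ u → P u × c u ≡ α) → j ≤ # P?
#-cover P? c hit = #-image P? (proj₁ ∘ hit)
  (λ {α} {β} eq → trans (sym (proj₂ (proj₂ (hit α)))) (trans (cong c eq) (proj₂ (proj₂ (hit β)))))
  (proj₁ ∘ proj₂ ∘ hit)

#-cover-injective : (P? : Decidable P) (c : Fin n → Fin j) → # P? ≤ j → (∀ α → ∃ λ u → P u × c u ≡ α) →
                    ∀ {u w} → P u → P w → c u ≡ c w → u ≡ w
#-cover-injective {P = P} {j = j} P? c small hit {u} {w} Pu Pw cu≡cw with u ≟ᶠ w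
... | yes u≡w = u≡w
-- Without `w` all `j` colours still occur, as `u` stands in for it, but on fewer than `j` elements.
... | no u≢w  = contradiction (#-cover (P? ∖? w) c hit′) (<⇒≱ (subst (_≤ j) (#-remove P? w Pw) small))
  where
  hit′ : ∀ α → ∃ λ v → (P ∖ w) v × c v ≡ α
  hit′ α with hit α
  ... | v , Pv , cv≡α with v ≟ᶠ w
  ...   | yes refl = u , (Pu , u≢w) , trans cu≡cw cv≡α
  ...   | no v≢w   = v , (Pv , v≢w) , cv≡α

length-filter-tabulate : ∀ {m} {P : Pred (Fin m) 0ℓ} (P? : Decidable P) (f : Fin n → Fin m) →
                         length (filter P? (tabulate f)) ≡ # (P? ∘ f)
length-filter-tabulate {zero} P? f = refl
length-filter-tabulate {suc n} P? f with P? (f zero)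
... | yes _ = cong suc (length-filter-tabulate P? (f ∘ suc))
... | no _  = length-filter-tabulate P? (f ∘ suc)

degree≡# : (G : Graph n) (v : Fin n) → degree G v ≡ # (Graph._~?_ G v)
degree≡# G v = length-filter-tabulate (Graph._~?_ G v) id

-- Partitions into two sides with one vertex left over

infixl 30 _[_↦_]
_[_↦_] : (Fin n → A) → Fin n → A → Fin n → A
(f [ x ↦ a ]) u = if does (u ≟ᶠ x) then a else f u

↦-at : (f : Fin n → A) (x : Fin n) {a : A} → (f [ x ↦ a ]) x ≡ a
↦-at f x rewrite dec-true (x ≟ᶠ x) refl = refl

↦-off : (f : Fin n → A) {x u : Fin n} {a : A} → u ≢ x → (f [ x ↦ a ]) u ≡ f u
↦-off f {x} {u} u≢x rewrite dec-false (u ≟ᶠ x) u≢x = refl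

sum-pick : (f : Fin n → ℕ) (x : Fin n) → sum f ≡ f x + sum (f [ x ↦ 0 ])
sum-pick {suc n} f x = begin
  sum f                          ≡⟨ sum-remove {i = x} f ⟩
  f x + sum (f ∘ punchIn x)      ≡⟨ cong (f x +_) (sum-cong-≗ λ j → ↦-off f {x} {a = 0} (punchInᵢ≢i x j)) ⟨
  f x + sum (f₀ ∘ punchIn x)     ≡⟨ cong (λ b → f x + (b + sum (f₀ ∘ punchIn x))) (↦-at f x) ⟨
  f x + (f₀ x + sum (f₀ ∘ punchIn x)) ≡⟨ cong (f x +_) (sum-remove {i = x} f₀) ⟨
  f x + sum f₀                   ∎
  where
  open ≡-Reasoning
  f₀ : Fin (suc n) → ℕ
  f₀ = f [ x ↦ 0 ]

module Colourings {n : ℕ} (G : Graph n) where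
  open Graph G public using (_~_; _~?_)

  ~-flip : u ~ v → v ~ u
  ~-flip = ~-sym G

  ~⇒≢ : u ~ v → u ≢ v
  ~⇒≢ u~v refl = ~-irr G refl u~v

  ProperOn : Pred (Fin n) 0ℓ → (Fin n → Fin j) → Set
  ProperOn P c = ∀ u w → P u → P w → u ~ w → c u ≢ c w

  -- The basic recolouring step. `P` and `Q` are kept apart because the coloured set usually changes
  -- too: `v` enters it, and other vertices may leave.
  proper-extend : {c : Fin n → Fin j} {γ : Fin j} → ProperOn P c →
                  (∀ u → Q u → u ≢ v → P u) → (∀ u → Q u → u ~ v → c u ≢ γ) →
                  ProperOn Q (c [ v ↦ γ ])
  proper-extend {v = v} {c = c} proper Q⊆P fresh u w Qu Qw u~w with u ≟ᶠ v | w ≟ᶠ v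
  ... | yes refl | yes refl = contradiction refl (~⇒≢ u~w)
  ... | yes refl | no _     = ≢-sym (fresh w Qw (~-flip u~w))
  ... | no _     | yes refl = fresh u Qu u~w
  ... | no u≢v   | no w≢v   = proper u w (Q⊆P u Qu u≢v) (Q⊆P w Qw w≢v) u~w

  -- No edge inside `P` joins `U` to its complement, so the two colourings never meet along an edge.
  merge : {U : Pred (Fin n) 0ℓ} (U? : Decidable U) {c₁ c₂ : Fin n → Fin j} →
          ProperOn (λ u → P u × U u) c₁ → ProperOn (λ u → P u × ¬ U u) c₂ →
          (∀ u w → P u → P w → U u → u ~ w → U w) →
          ProperOn P (λ u → if does (U? u) then c₁ u else c₂ u)
  merge U? p₁ p₂ closed u w Pu Pw u~w with U? u | U? w
  ... | yes Uu | yes Uw = p₁ u w (Pu , Uu) (Pw , Uw) u~w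
  ... | yes Uu | no ¬Uw = contradiction (closed u w Pu Pw Uu u~w) ¬Uw
  ... | no ¬Uu | yes Uw = contradiction (closed w u Pw Pu Uw (~-flip u~w)) ¬Uu
  ... | no ¬Uu | no ¬Uw = p₂ u w (Pu , ¬Uu) (Pw , ¬Uw) u~w

  colourableOn? : Decidable P → ∀ j → Dec (∃ λ (c : Fin n → Fin j) → ProperOn P c)
  colourableOn? P? k =
    map′ (λ (xs , p) → lookupᵛ xs , p)
         (λ (c , p) → tabulateᵛ c , λ u w Pu Pw u~w eq → p u w Pu Pw u~w
           (trans (sym (lookup∘tabulate c u)) (trans eq (lookup∘tabulate c w))))
         (anyVec? λ xs → all? λ u → all? λ w →
           P? u →-dec (P? w →-dec ((u ~? w) →-dec ¬? (lookupᵛ xs u ≟ᶠ lookupᵛ xs w))))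

module Partitions {n : ℕ} (G : Graph n) (r : Bool → ℕ) where
  open Colourings G public

  SplitColouring : (Fin n → Bool) → Set
  SplitColouring σ = ∀ s → ∃ λ (c : Fin n → Fin (r s)) → ProperOn (λ u → σ u ≡ s) c

  -- The side of `v` itself does not enter, so `v` remains a witness when it changes sides.
  record Witness (σ : Fin n → Bool) (v : Fin n) : Set where
    constructor witness
    field
      colouring : ∀ s → ∃ λ (c : Fin n → Fin (r s)) → ProperOn (λ u → σ u ≡ s × u ≢ v) c
  open Witness

  witness? : ∀ σ → Decidable (Witness σ)
  witness? σ v = map′ (λ { (f , t) → witness λ { false → f ; true → t } }) (λ W → colouring W false , colouring W true)
    (side false ×-dec side true)
    where
    side : ∀ s → Dec (∃ λ (c : Fin n → Fin (r s)) → ProperOn (λ u → σ u ≡ s × u ≢ v) c)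
    side s = colourableOn? (λ u → σ u ≟ᵇ s ×-dec ¬? (u ≟ᶠ v)) (r s)

  Flip : (Fin n → Bool) → Fin n → Fin n → Bool
  Flip σ x = σ [ x ↦ not (σ x) ]

  Low : Fin n → Set
  Low v = degree G v ≤ r false + r true

  low? : Decidable Low
  low? v = degree G v ≤? r false + r true

  side-sum : ∀ s → r s + r (not s) ≡ r false + r true
  side-sum false = refl
  side-sum true  = +-comm (r true) (r false)

  N : (Fin n → Bool) → Bool → Fin n → Pred (Fin n) 0ℓ
  N σ s v u = v ~ u × σ u ≡ s

  N? : ∀ σ s v → Decidable (N σ s v)
  N? σ s v u = v ~? u ×-dec σ u ≟ᵇ s

  d : (Fin n → Bool) → Bool → Fin n → ℕ
  d σ s v = # (N? σ s v)

  degree-split : ∀ σ s v → degree G v ≡ d σ s v + d σ (not s) v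
  degree-split σ s v = trans (degree≡# G v) (trans (#-split (v ~?_) (λ u → σ u ≟ᵇ s))
    (cong (d σ s v +_) (#-cong (λ u → v ~? u ×-dec ¬? (σ u ≟ᵇ s)) (N? σ (not s) v)
      (λ u (v~u , σu≢s) → v~u , ¬-not σu≢s)
      (λ u (v~u , σu≡) → v~u , λ σu≡s → not-¬ σu≡s σu≡))))

  d-flip : ∀ σ s v → d (Flip σ v) s v ≡ d σ s v
  d-flip σ s v = #-cong (N? (Flip σ v) s v) (N? σ s v)
    (λ u (v~u , e) → v~u , trans (sym (↦-off σ (≢-sym (~⇒≢ v~u)))) e)
    (λ u (v~u , e) → v~u , trans (↦-off σ (≢-sym (~⇒≢ v~u))) e)

  -- Edges inside a side are counted twice, hence the factor 2.
  cost : (Fin n → Bool) → ℕ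
  cost σ = sum λ v → d σ (σ v) v + 2 * r (not (σ v))

  -- The part of the cost that does not depend on the side of v.
  private
    rest : (Fin n → Bool) → Fin n → ℕ
    rest σ v = sum ((λ u → # (N? σ (σ u) u ∖? v) + 2 * r (not (σ u))) [ v ↦ 0 ])

  -- An edge from `v` inside its side is counted once at `v` and once at the other end. Together
  -- with the weight of `v` this makes twice the bracket; everything else is `rest`.
  cost-at : ∀ σ v → cost σ ≡ rest σ v + 2 * (d σ (σ v) v + r (not (σ v)))
  cost-at σ v = begin
    cost σ                                    ≡⟨ sum-pick g v ⟩
    g v + sum (g [ v ↦ 0 ])                   ≡⟨ cong (g v +_) (trans (sum-cong-≗ pointwise) (∑-distrib-+ m h)) ⟩
    g v + (d σ (σ v) v + rest σ v)            ≡⟨ arith (d σ (σ v) v) (r (not (σ v))) (rest σ v) ⟩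
    rest σ v + 2 * (d σ (σ v) v + r (not (σ v))) ∎
    where
    open ≡-Reasoning
    g h m : Fin n → ℕ
    g u = d σ (σ u) u + 2 * r (not (σ u))
    h = (λ u → # (N? σ (σ u) u ∖? v) + 2 * r (not (σ u))) [ v ↦ 0 ]
    m u = bit (does (N? σ (σ v) v u))
    arith : ∀ a b c → (a + 2 * b) + (a + c) ≡ c + 2 * (a + b)
    arith = solve 3 (λ a b c → (a :+ con 2 :* b) :+ (a :+ c) := c :+ con 2 :* (a :+ b)) refl
      where open +-*-Solver
    pointwise : ∀ u → (g [ v ↦ 0 ]) u ≡ m u + h u
    pointwise u with u ≟ᶠ v
    ... | yes refl rewrite dec-false (N? σ (σ v) v v) (λ (v~v , _) → ~⇒≢ v~v refl) = refl
    ... | no u≢v = trans (cong (_+ 2 * r (not (σ u))) (#-remove-bit (N? σ (σ u) u) v))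
        (trans (cong (λ b → bit b + # (N? σ (σ u) u ∖? v) + 2 * r (not (σ u)))
                 (does-cong (N? σ (σ u) u v) (N? σ (σ v) v u)
                   (λ (u~v , e) → ~-flip u~v , sym e) (λ (v~u , e) → ~-flip v~u , sym e)))
               (+-assoc (m u) _ _))

  rest-flip : ∀ σ v → rest (Flip σ v) v ≡ rest σ v
  rest-flip σ v = sum-cong-≗ pointwise
    where
    pointwise : ∀ u → ((λ u → # (N? (Flip σ v) (Flip σ v u) u ∖? v) + 2 * r (not (Flip σ v u))) [ v ↦ 0 ]) u
                    ≡ ((λ u → # (N? σ (σ u) u ∖? v) + 2 * r (not (σ u))) [ v ↦ 0 ]) u
    pointwise u with u ≟ᶠ v
    ... | yes _ = refl
    ... | no u≢v = cong (_+ 2 * r (not (σ u))) (#-cong (N? (Flip σ v) (σ u) u ∖? v) (N? σ (σ u) u ∖? v)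
        (λ w ((u~w , e) , w≢v) → (u~w , trans (sym (↦-off σ w≢v)) e) , w≢v)
        (λ w ((u~w , e) , w≢v) → (u~w , trans (↦-off σ w≢v) e) , w≢v))

  cost-flip : ∀ σ v → cost (Flip σ v) ≡ rest σ v + 2 * (d σ (not (σ v)) v + r (σ v))
  cost-flip σ v = trans (cost-at (Flip σ v) v) (cong₂ (λ a b → a + 2 * b) (rest-flip σ v)
    (trans (cong (λ s → d (Flip σ v) s v + r (not s)) (↦-at σ v))
           (cong₂ _+_ (d-flip σ (not (σ v)) v) (cong r (not-involutive (σ v))))))

  record Minimal (σ : Fin n → Bool) : Set where
    constructor minimally
    field
      least : ∀ τ v → Witness τ v → cost σ ≤ cost τ
  open Minimal

  -- Descent on the cost. As the goal is a contradiction, no minimum has to be found: a cheaper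
  -- partition with a witness is refuted by induction.
  minimal-suffices : (∀ σ v → Minimal σ → Witness σ v → ⊥) → ∀ σ v → ¬ Witness σ v
  minimal-suffices h σ v W = go σ v W (<-wellFounded (cost σ))
    where
    go : ∀ σ v → Witness σ v → Acc _<_ (cost σ) → ⊥
    go σ v W (acc rs) = h σ v minimal W
      where
      minimal : Minimal σ
      minimal .least τ w W′ with cost σ ≤? cost τ
      ... | yes p = p
      ... | no ¬p = ⊥-elim (go τ w W′ (rs (≰⇒> ¬p)))

  witness-flip : ∀ {σ} → Witness σ v → Witness (Flip σ v) v
  witness-flip {σ = σ} W .colouring s = proj₁ (colouring W s) , λ u w (e , u≢v) (e′ , w≢v) →
    proj₂ (colouring W s) u w (trans (sym (↦-off σ u≢v)) e , u≢v) (trans (sym (↦-off σ w≢v)) e′ , w≢v)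

  -- Witnesses of a minimal partition

  module Uncolourable (uncolourable : ∀ σ → ¬ SplitColouring σ)
                      (bounded : ∀ v → degree G v ≤ suc (r false + r true)) where

    private
      variable
        σ : Fin n → Bool

    -- If `α` were missing among the neighbours of `v` on side `s`, then `v` could join that side
    -- with colour `α`, and both sides would be fully coloured.
    saturated : ∀ {s} {c : Fin n → Fin (r s)} → Witness σ v → ProperOn (λ u → σ u ≡ s × u ≢ v) c →
                ∀ α → ∃ λ u → N σ s v u × c u ≡ α
    saturated {σ = σ} {v = v} {s} {c} W proper α with any? (λ u → N? σ s v u ×-dec c u ≟ᶠ α)
    ... | yes found = found
    ... | no none = contradiction split (uncolourable (σ [ v ↦ s ]))
      where
      split : SplitColouring (σ [ v ↦ s ])
      split t with t ≟ᵇ s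
      ... | yes refl = c [ v ↦ α ] , proper-extend proper
              (λ u e u≢v → trans (sym (↦-off σ u≢v)) e , u≢v)
              (λ u e u~v cu≡α → none (u , (~-flip u~v , trans (sym (↦-off σ (~⇒≢ u~v))) e) , cu≡α))
      ... | no t≢s = proj₁ (colouring W t) , λ u w e e′ → proj₂ (colouring W t) u w (off e) (off e′)
        where
        off : ∀ {u} → (σ [ v ↦ s ]) u ≡ t → σ u ≡ t × u ≢ v
        off {u} e = trans (sym (↦-off σ u≢v)) e , u≢v
          where
          u≢v : u ≢ v
          u≢v refl = t≢s (trans (sym e) (↦-at σ v))

    degree-≥ : Witness σ v → ∀ s → r s ≤ d σ s v
    degree-≥ {σ = σ} {v = v} W s = #-cover (N? σ s v) (proj₁ (colouring W s)) (saturated W (proj₂ (colouring W s)))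

    -- Saturation gives at least `r s`. If there were more, the degree bound would leave at most
    -- `r (not s)` neighbours on the other side, and moving `v` there would lower the cost.
    own-degree : Minimal σ → Witness σ v → ∀ {s} → σ v ≡ s → d σ s v ≡ r s
    own-degree {σ = σ} {v = v} minimal W refl with d σ (σ v) v ≤? r (σ v)
    ... | yes p = ≤-antisym p (degree-≥ W (σ v))
    ... | no ¬p = contradiction (least minimal (Flip σ v) v (witness-flip {σ = σ} W)) (<⇒≱ (begin-strict
      cost (Flip σ v)                                ≡⟨ cost-flip σ v ⟩
      rest σ v + 2 * (d σ (not s) v + r s)           <⟨ +-monoʳ-< (rest σ v) (*-monoʳ-< 2 smaller) ⟩
      rest σ v + 2 * (d σ s v + r (not s))           ≡⟨ cost-at σ v ⟨
      cost σ                                         ∎))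
      where
      open ≤-Reasoning
      s = σ v
      other : d σ (not s) v ≤ r (not s)
      other = +-cancelˡ-≤ (suc (r s)) _ _ (begin
        suc (r s) + d σ (not s) v      ≤⟨ +-monoˡ-≤ _ (≰⇒> ¬p) ⟩
        d σ s v + d σ (not s) v        ≡⟨ degree-split σ s v ⟨
        degree G v                     ≤⟨ bounded v ⟩
        suc (r false + r true)         ≡⟨ cong suc (side-sum s) ⟨
        suc (r s) + r (not s)          ∎)
      smaller : d σ (not s) v + r s < d σ s v + r (not s)
      smaller = begin-strict
        d σ (not s) v + r s    ≤⟨ +-monoˡ-≤ (r s) other ⟩
        r (not s) + r s        <⟨ +-monoʳ-< (r (not s)) (≰⇒> ¬p) ⟩
        r (not s) + d σ s v    ≡⟨ +-comm (r (not s)) _ ⟩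
        d σ s v + r (not s)    ∎

    low-degree : Witness σ v → Low v → ∀ s → d σ s v ≡ r s
    low-degree {σ = σ} {v = v} W low s = ≤-antisym (+-cancelʳ-≤ (r (not s)) _ _ (begin
      d σ s v + r (not s)       ≤⟨ +-monoʳ-≤ (d σ s v) (degree-≥ W (not s)) ⟩
      d σ s v + d σ (not s) v   ≡⟨ degree-split σ s v ⟨
      degree G v                ≤⟨ low ⟩
      r false + r true          ≡⟨ side-sum s ⟨
      r s + r (not s)           ∎)) (degree-≥ W s)
      where open ≤-Reasoning

    low-witness-degree : Witness σ v → Low v → degree G v ≡ r false + r true
    low-witness-degree {σ = σ} {v = v} W low = trans (degree-split σ false v)
      (cong₂ _+_ (low-degree W low false) (low-degree W low true))

    -- A low witness has exactly `r s` neighbours on each side `s`, so its share of the cost is the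
    -- same on both sides.
    flip-minimal : Minimal σ → Witness σ v → Low v → Minimal (Flip σ v)
    flip-minimal {σ = σ} {v = v} minimal W low .least τ u W′ = subst (_≤ cost τ) same (least minimal τ u W′)
      where
      open ≡-Reasoning
      s = σ v
      same : cost σ ≡ cost (Flip σ v)
      same = begin
        cost σ                                ≡⟨ cost-at σ v ⟩
        rest σ v + 2 * (d σ s v + r (not s))  ≡⟨ cong (λ a → rest σ v + 2 * a) (begin
          d σ s v + r (not s)                   ≡⟨ cong₂ _+_ (low-degree W low s) (sym (low-degree W low (not s))) ⟩
          r s + d σ (not s) v                   ≡⟨ +-comm (r s) _ ⟩
          d σ (not s) v + r s                   ∎) ⟩
        rest σ v + 2 * (d σ (not s) v + r s)  ≡⟨ cost-flip σ v ⟨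
        cost (Flip σ v)                       ∎

    -- The `r s` neighbours of `v` on its own side carry all `r s` colours, hence each colour once.
    rainbow : ∀ {s} {c : Fin n → Fin (r s)} → Minimal σ → Witness σ v → σ v ≡ s →
              ProperOn (λ u → σ u ≡ s × u ≢ v) c →
              N σ s v u → N σ s v w → c u ≡ c w → u ≡ w
    rainbow {σ = σ} {v = v} {s = s} {c} minimal W e proper =
      #-cover-injective (N? σ s v) c (≤-reflexive (own-degree minimal W e)) (saturated W proper)

    -- Uncolour `u` and give its colour to `v`: by `rainbow` no other neighbour of `v` on this side
    -- has it.
    neighbour-witness : Minimal σ → Witness σ v → v ~ u → σ u ≡ σ v → Witness σ u
    neighbour-witness {σ = σ} {v = v} {u = u} minimal W v~u σu≡σv .colouring s with colouring W s | s ≟ᵇ σ v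
    ... | c , proper | yes refl = c [ v ↦ c u ] , proper-extend proper
            (λ w (σw , w≢u) w≢v → σw , w≢v)
            (λ w (σw , w≢u) w~v cw≡cu →
              w≢u (rainbow minimal W refl proper (~-flip w~v , σw) (v~u , σu≡σv) cw≡cu))
    ... | c , proper | no s≢σv = c , λ w w′ (σw , _) (σw′ , _) →
            proper w w′ (σw , λ { refl → s≢σv (sym σw) }) (σw′ , λ { refl → s≢σv (sym σw′) })

    -- If `w` lay outside `U`, the colouring that omits `w` could be used on `U` and the one that
    -- omits `v` outside `U`, and together they would colour everything. Hence all witnesses lie in
    -- one component of a side.
    connected : {U : Pred (Fin n) 0ℓ} → Decidable U → (∀ u w → U u → u ~ w → σ u ≡ σ w → U w) →
                Witness σ v → U v → Witness σ w → U w
    connected {σ = σ} {v = v} {w = w} U? closed V Uv W = decidable-stable (U? w) λ ¬Uw →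
      uncolourable σ λ s → _ , merge U?
        (λ u u′ (e , Uu) (e′ , Uu′) → proj₂ (colouring W s) u u′ (e , λ { refl → ¬Uw Uu }) (e′ , λ { refl → ¬Uw Uu′ }))
        (λ u u′ (e , ¬Uu) (e′ , ¬Uu′) → proj₂ (colouring V s) u u′ (e , λ { refl → ¬Uu Uv }) (e′ , λ { refl → ¬Uu′ Uv }))
        (λ u u′ e e′ Uu u~u′ → closed u u′ Uu u~u′ (trans e (sym e′)))

    same-side : Witness σ v → Witness σ w → σ w ≡ σ v
    same-side {σ = σ} {v = v} V W =
      connected (λ u → σ u ≟ᵇ σ v) (λ u w e _ e′ → trans (sym e′) e) V refl W

    -- A Kempe change. If `w` were outside `U`, exchanging the colours of `u` and `w` on `U` alone
    -- would keep the colouring proper and give two neighbours of `y` the same colour, against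
    -- `rainbow`. So removing `y` does not separate its neighbours on side `s`.
    linked : ∀ {s y} {U : Pred (Fin n) 0ℓ} → Minimal σ → Witness σ y → σ y ≡ s → Decidable U →
             (∀ u w → U u → u ~ w → σ u ≡ s → σ w ≡ s → w ≢ y → U w) →
             N σ s y u → U u → N σ s y w → U w
    linked {σ = σ} {u = u} {w = w} {s} {y} {U} minimal W e U? closed Nu Uu Nw =
      decidable-stable (U? w) λ ¬Uw →
        ¬Uw (subst U (rainbow minimal W e recoloured Nu Nw (begin
          c′ u          ≡⟨ cong (λ b → if b then swap (c u) else c u) (dec-true (U? u) Uu) ⟩
          swap (c u)    ≡⟨ swap-u ⟩
          c w           ≡⟨ cong (λ b → if b then swap (c w) else c w) (dec-false (U? w) ¬Uw) ⟨
          c′ w          ∎)) Uu)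
      where
      open ≡-Reasoning
      c : Fin n → Fin (r s)
      c = proj₁ (colouring W s)
      swap : Fin (r s) → Fin (r s)
      swap α = if does (α ≟ᶠ c u) then c w else if does (α ≟ᶠ c w) then c u else α
      swap-u : swap (c u) ≡ c w
      swap-u rewrite dec-true (c u ≟ᶠ c u) refl = refl
      swap≡transpose : ∀ α → swap α ≡ transpose (c u) (c w) α
      swap≡transpose α with does (α ≟ᶠ c u)
      ... | true = refl
      ... | false with does (α ≟ᶠ c w)
      ...   | true = refl
      ...   | false = refl
      swap-injective : ∀ {α β} → swap α ≡ swap β → α ≡ β
      swap-injective {α} {β} eq = trans (sym (transpose-inverse (c w) (c u))) (trans
        (cong (transpose (c w) (c u)) (trans (sym (swap≡transpose α)) (trans eq (swap≡transpose β))))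
        (transpose-inverse (c w) (c u)))
      c′ : Fin n → Fin (r s)
      c′ v = if does (U? v) then swap (c v) else c v
      recoloured : ProperOn (λ v → σ v ≡ s × v ≢ y) c′
      recoloured = merge U?
        (λ v v′ (p , _) (p′ , _) v~v′ eq → proj₂ (colouring W s) v v′ p p′ v~v′ (swap-injective eq))
        (λ v v′ (p , _) (p′ , _) → proj₂ (colouring W s) v v′ p p′)
        (λ v v′ (e , _) (e′ , v′≢y) Uv v~v′ → closed v v′ Uv v~v′ e e′ v′≢y)

    -- If the witness component of τ without x survives in τ′ as a component without y,
    -- then y can only be attached to it in the way x is.
    replacement : ∀ {τ τ′ s x y} → Minimal τ → Minimal τ′ → Witness τ x → Witness τ′ y → τ x ≡ s → τ′ y ≡ s →
                  (∀ u → Witness τ u → u ≢ x → τ′ u ≡ s × u ≢ y) →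
                  (∀ u v → Witness τ u → u ≢ x → u ~ v → τ′ v ≡ s → v ≢ y → τ v ≡ s × v ≢ x) →
                  y ~ u → Witness τ u → u ≢ x →
                  (∀ w → N τ′ s y w → N τ s x w) × (∀ w → N τ s x w → N τ′ s y w)
    replacement {u = u} {τ = τ} {τ′} {s} {x} {y} min min′ X Y τx τ′y stays closed y~u U u≢x =
      -- Both neighbourhoods have `r s` elements, so one inclusion gives the other.
      forward , #-tight (N? τ′ s y) (N? τ s x) forward
        (≤-reflexive (trans (own-degree min X τx) (sym (own-degree min′ Y τ′y))))
      where
      τ-side : ∀ {w} → Witness τ w → τ w ≡ s
      τ-side W = trans (same-side X W) τx
      within : ∀ w → N τ′ s y w → Witness τ w × w ≢ x
      within w Nw = linked min′ Y τ′y (λ w → witness? τ w ×-dec ¬? (w ≟ᶠ x))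
        (λ v v′ (V , v≢x) v~v′ _ τ′v′ v′≢y → let τv′ , v′≢x = closed v v′ V v≢x v~v′ τ′v′ v′≢y in
          neighbour-witness min V v~v′ (trans τv′ (sym (τ-side V))) , v′≢x)
        (y~u , proj₁ (stays u U u≢x)) (U , u≢x) Nw
      forward : ∀ w → N τ′ s y w → N τ s x w
      forward w Nw@(y~w , τ′w) with within w Nw
      -- If `x` were not adjacent to `w`, all `r s` neighbours of `w` on its side would remain in
      -- `τ′` and `y` would be one more. But `w` is a witness of `τ′` too, with exactly `r s` such
      -- neighbours.
      ... | W , w≢x = decidable-stable (x ~? w) (λ x≁w →
          <-irrefl (trans (own-degree min W (τ-side W))
                     (sym (own-degree min′ (neighbour-witness min′ Y y~w (trans τ′w (sym τ′y))) τ′w)))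
            (#-strict (N? τ s w) (N? τ′ s w)
              (λ v Nv → proj₁ Nv , proj₁ (moved x≁w v Nv))
              (~-flip y~w , τ′y) (λ Ny → proj₂ (moved x≁w y Ny) refl)))
          , τ-side W
        where
        moved : ¬ (x ~ w) → ∀ v → N τ s w v → τ′ v ≡ s × v ≢ y
        moved x≁w v (w~v , τv) = stays v (neighbour-witness min W w~v (trans τv (sym (τ-side W))))
          λ { refl → x≁w (~-flip w~v) }

    -- Forks and vertices with equal closed neighbourhoods

    record Fork : Set where
      field
        {π}      : Fin n → Bool
        {p p′ q} : Fin n
        minimal  : Minimal π
        X        : Witness π p
        X′       : Witness π p′
        p≢p′     : p ≢ p′
        p-low    : Low p
        p′-low   : Low p′
        q-low    : Low q
        q-side   : π q ≡ not (π p)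
        p~q      : p ~ q
        p′~q     : p′ ~ q

    N[_] : Fin n → Pred (Fin n) 0ℓ
    N[ a ] w = w ≡ a ⊎ a ~ w

    _≈_ : Fin n → Fin n → Set
    a ≈ b = ∀ w → (N[ a ] w → N[ b ] w) × (N[ b ] w → N[ a ] w)

    side-cases : ∀ (a b : Bool) → a ≡ b ⊎ a ≡ not b
    side-cases a b with a ≟ᵇ b
    ... | yes e = inj₁ e
    ... | no ne = inj₂ (¬-not ne)

    sides≢ : ∀ {b : Bool} → σ u ≡ b → σ v ≡ not b → u ≢ v
    sides≢ e e′ refl = not-¬ e e′

    module _ (F : Fork) where
      open Fork F

      private
        πˣ : Fin n → Bool
        πˣ = Flip π p
        q≢p : q ≢ p
        q≢p = ≢-sym (~⇒≢ p~q)
        πˣp : πˣ p ≡ not (π p)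
        πˣp = ↦-at π p
        πˣq : πˣ q ≡ not (π p)
        πˣq = trans (↦-off π q≢p) q-side
        minimalˣ : Minimal πˣ
        minimalˣ = flip-minimal minimal X p-low
        Xˣ : Witness πˣ p
        Xˣ = witness-flip X
        Yˣ : Witness πˣ q
        Yˣ = neighbour-witness minimalˣ Xˣ p~q (trans πˣq (sym πˣp))

      -- Move `p` across and then `q` back. Through `p′`, the vertex `q` is attached to what remains
      -- of the old witness component, so by `replacement` it is attached just as `p` was.
      fork-side : ∀ w → π w ≡ π p → (N[ p ] w → q ~ w) × (q ~ w → N[ p ] w)
      fork-side w πw = to , from
        where
        πˣʸ : Fin n → Bool
        πˣʸ = Flip πˣ q
        off : ∀ {v} → v ≢ p → v ≢ q → πˣʸ v ≡ π v
        off v≢p v≢q = trans (↦-off πˣ v≢q) (↦-off π v≢p)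
        πˣʸq : πˣʸ q ≡ π p
        πˣʸq = trans (↦-at πˣ q) (trans (cong not πˣq) (not-involutive (π p)))
        πˣʸp : πˣʸ p ≡ not (π p)
        πˣʸp = trans (↦-off πˣ (≢-sym q≢p)) πˣp
        R : (∀ v → N πˣʸ (π p) q v → N π (π p) p v) × (∀ v → N π (π p) p v → N πˣʸ (π p) q v)
        R = replacement minimal (flip-minimal minimalˣ Yˣ q-low) X (witness-flip Yˣ) refl πˣʸq
          (λ u U u≢p → let u≢q = sides≢ (same-side X U) q-side in
            trans (off u≢p u≢q) (same-side X U) , u≢q)
          (λ u v _ _ _ e v≢q → let v≢p = sides≢ {σ = πˣʸ} e πˣʸp in trans (sym (off v≢p v≢q)) e , v≢p)
          (~-flip p′~q) X′ (≢-sym p≢p′)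
        to : N[ p ] w → q ~ w
        to (inj₁ refl) = ~-flip p~q
        to (inj₂ p~w)  = proj₁ (proj₂ R w (p~w , πw))
        from : q ~ w → N[ p ] w
        from q~w with w ≟ᶠ p
        ... | yes w≡p = inj₁ w≡p
        ... | no w≢p  = inj₂ (proj₁ (proj₁ R w (q~w , trans (off w≢p (≢-sym (~⇒≢ q~w))) πw)))

      fork-swap : Fork
      fork-swap = record
        { minimal = minimal ; X = X′ ; X′ = X ; p≢p′ = ≢-sym p≢p′
        ; p-low = p′-low ; p′-low = p-low ; q-low = q-low
        ; q-side = trans q-side (cong not (sym (same-side X X′))) ; p~q = p′~q ; p′~q = p~q }

      fork-shift : Fork
      fork-shift = record
        { minimal = minimalˣ ; X = Xˣ ; X′ = Yˣ ; p≢p′ = ≢-sym q≢p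
        ; p-low = p-low ; p′-low = q-low ; q-low = p′-low
        ; q-side = trans (↦-off π (≢-sym p≢p′)) (trans (same-side X X′)
            (sym (trans (cong not πˣp) (not-involutive (π p)))))
        ; p~q = p~p′ ; p′~q = ~-flip p′~q }
        where
        p~p′ : p ~ p′
        p~p′ with proj₂ (fork-side p′ (same-side X X′)) (~-flip p′~q)
        ... | inj₁ p′≡p = contradiction (sym p′≡p) p≢p′
        ... | inj₂ p    = p

    module _ (F : Fork) where
      open Fork F

      private
        other : ∀ {w} → π w ≡ not (π p) → Flip π p w ≡ Flip π p p
        other {w} e = trans (↦-off π (λ { refl → not-¬ refl e })) (trans e (sym (↦-at π p)))
        p-q : Flip π p q ≡ Flip π p p
        p-q = other q-side
        strip : ∀ {a w} → N[ a ] w → w ≢ a → a ~ w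
        strip (inj₁ e) ne = contradiction e ne
        strip (inj₂ p) _  = p

      -- On the side of `p` both are compared with `q`. On the other side the shifted fork applies,
      -- where `p′` has the role of `q`.
      fork-p≈p′ : p ≈ p′
      fork-p≈p′ w with side-cases (π w) (π p)
      ... | inj₁ e = (λ p → proj₂ (fork-side (fork-swap F) w e′) (proj₁ (fork-side F w e) p))
                   , (λ p → proj₂ (fork-side F w e) (proj₁ (fork-side (fork-swap F) w e′) p))
        where
        e′ : π w ≡ π p′
        e′ = trans e (sym (same-side X X′))
      ... | inj₂ e = (λ p → inj₂ (proj₁ S p)) , (λ p → proj₂ S (strip p (≢-sym (sides≢ (same-side X X′) e))))
        where
        S : (N[ p ] w → p′ ~ w) × (p′ ~ w → N[ p ] w)
        S = fork-side (fork-shift F) w (other e)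

      -- On the side of `p` this is `fork-side`. On the other side `p` and `q` are the two witnesses
      -- of the shifted fork, and both are compared with `p′`.
      fork-p≈q : p ≈ q
      fork-p≈q w with side-cases (π w) (π p)
      ... | inj₁ e = (λ p → inj₂ (proj₁ (fork-side F w e) p))
                   , (λ p → proj₂ (fork-side F w e) (strip p (sides≢ e q-side)))
      ... | inj₂ e = (λ p → proj₂ S′ (proj₁ S p)) , (λ p → proj₂ S (proj₁ S′ p))
        where
        S : (N[ p ] w → p′ ~ w) × (p′ ~ w → N[ p ] w)
        S = fork-side (fork-shift F) w (other e)
        S′ : (N[ q ] w → p′ ~ w) × (p′ ~ w → N[ q ] w)
        S′ = fork-side (fork-swap (fork-shift F)) w (trans (other e) (sym p-q))

    -- The vertex `a` can replace `p′` in the fork if it is on the side of `p`, and `q` otherwise.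
    low-twin : (F : Fork) → let open Fork F in ∀ a → Low a → p ~ a → p ≈ a
    low-twin F a a-low p~a with side-cases (Fork.π F a) (Fork.π F (Fork.p F))
    ... | inj₁ e = fork-p≈p′ (record
          { minimal = minimal ; X = X ; X′ = neighbour-witness minimal X p~a e ; p≢p′ = ~⇒≢ p~a
          ; p-low = p-low ; p′-low = a-low ; q-low = q-low ; q-side = q-side ; p~q = p~q
          ; p′~q = ~-flip (proj₁ (fork-side F a e) (inj₂ p~a)) })
      where open Fork F
    ... | inj₂ e = fork-p≈q (record
          { minimal = minimal ; X = X ; X′ = X′ ; p≢p′ = p≢p′
          ; p-low = p-low ; p′-low = p′-low ; q-low = a-low ; q-side = e ; p~q = p~a
          ; p′~q = p′~a })
      where
      open Fork F
      p′~a : p′ ~ a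
      p′~a with proj₁ (fork-p≈p′ F a) (inj₂ p~a)
      ... | inj₁ refl = contradiction (same-side X X′) (λ e′ → not-¬ e′ e)
      ... | inj₂ p    = p

    -- Endless sequences of moves

    record Move (σ : Fin n → Bool) (a : Fin n) : Set where
      field
        {mover stayer} : Fin n
        mover-witness  : Witness σ mover
        stayer-witness : Witness σ stayer
        mover-low      : Low mover
        stayer-low     : Low stayer
        mover~stayer   : mover ~ stayer
        -- Here `a` is the vertex moved last: it must not go straight back.
        mover≢         : mover ≢ a

    record State : Set where
      field
        part     : Fin n → Bool
        previous : Fin n
        minimal  : Minimal part
        move     : Move part previous
      open Move move public

    record Trajectory : Set where
      field
        part           : ℕ → Fin n → Bool
        mover stayer   : ℕ → Fin n
        minimal        : ∀ i → Minimal (part i)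
        mover-witness  : ∀ i → Witness (part i) (mover i)
        stayer-witness : ∀ i → Witness (part i) (stayer i)
        mover-low      : ∀ i → Low (mover i)
        stayer-low     : ∀ i → Low (stayer i)
        mover~stayer   : ∀ i → mover i ~ stayer i
        mover≢         : ∀ i → mover (suc i) ≢ mover i
        part-suc       : ∀ i → part (suc i) ≡ Flip (part i) (mover i)

      moved-witness : ∀ i → Witness (part (suc i)) (mover i)
      moved-witness i = subst (λ σ → Witness σ (mover i)) (sym (part-suc i)) (witness-flip (mover-witness i))

      part-at : ∀ i → part (suc i) (mover i) ≡ not (part i (mover i))
      part-at i rewrite part-suc i = ↦-at (part i) (mover i)

      part-off : ∀ i {u} → u ≢ mover i → part (suc i) u ≡ part i u
      part-off i u≢ rewrite part-suc i = ↦-off (part i) u≢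

    -- The witness component of τ without x is, in σ, still a component, but not the witness component.
    record Left (τ : Fin n → Bool) (x : Fin n) (σ : Fin n → Bool) : Set where
      field
        stays  : ∀ u → Witness τ u → u ≢ x → σ u ≡ τ x
        closed : ∀ u v → Witness τ u → u ≢ x → u ~ v → σ v ≡ τ x → τ v ≡ τ x × v ≢ x
        quiet  : ∀ u → Witness τ u → u ≢ x → ¬ Witness σ u

    -- `low-edge` provides a next move at every stage. `wide` provides a second neighbour, from
    -- which a late return to an old component yields a fork.
    module Bounce
      (low-edge : ∀ σ v → Minimal σ → Witness σ v →
                  ∃₂ λ p q → Witness σ p × Witness σ q × Low p × Low q × p ~ q)
      (wide : ∀ s → 2 ≤ r (not s) ⊎ (2 ≤ r s × (∀ v → Low v)))
      (no-fork : ¬ Fork)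
      where

      module OnTrajectory (T : Trajectory) where
        open Trajectory T

        LeftAt : ℕ → ℕ → Set
        LeftAt i m = Left (part i) (mover i) (part m)

        last-left : ∀ m → LeftAt m (suc m)
        last-left m = record
          { stays  = λ u U u≢x → trans (part-off m u≢x) (same-side (mover-witness m) U)
          ; closed = λ u v U u≢x u~v e → let v≢x = sides≢ {σ = part (suc m)} e (part-at m) in
              trans (sym (part-off m v≢x)) e , v≢x
          ; quiet  = λ u U u≢x U′ → not-¬ (trans (part-off m u≢x) (same-side (mover-witness m) U))
              (trans (same-side (moved-witness m) U′) (part-at m))
          }

        module _ {m i : ℕ} (L : LeftAt i m) where
          open Left L

          next-stays : ∀ u → Witness (part i) u → u ≢ mover i →
                       part (suc m) u ≡ part i (mover i) × u ≢ mover m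
          next-stays u U u≢x = trans (part-off m u≢y) (stays u U u≢x) , u≢y
            where
            u≢y : u ≢ mover m
            u≢y refl = quiet u U u≢x (mover-witness m)

          next-closed : ∀ u v → Witness (part i) u → u ≢ mover i → u ~ v →
                        part (suc m) v ≡ part i (mover i) → v ≢ mover m →
                        part i v ≡ part i (mover i) × v ≢ mover i
          next-closed u v U u≢x u~v e v≢y = closed u v U u≢x u~v (trans (sym (part-off m v≢y)) e)

        -- If the mover `y` joined the component left at stage `i`, then by `replacement` it would
        -- be attached just as `x` was. In particular the stayer `z` would be a witness again, and a
        -- fork is found from this.
        no-return : ∀ m → (∀ i → i < m → LeftAt i m) → ∀ i → i < m →
                    ∀ u → Witness (part i) u → u ≢ mover i → u ~ mover m →
                    part (suc m) (mover m) ≢ part i (mover i)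
        no-return m left i i<m u U u≢x u~y y-side = finish (m≤n⇒m<n∨m≡n i<m)
          where
          x y z : Fin n
          x = mover i
          y = mover m
          z = stayer i
          s : Bool
          s = part i x
          σ′ : Fin n → Bool
          σ′ = part (suc m)

          R : (∀ w → N σ′ s y w → N (part i) s x w) × (∀ w → N (part i) s x w → N σ′ s y w)
          R = replacement (minimal i) (minimal (suc m)) (mover-witness i)
            (moved-witness m) refl y-side
            (next-stays (left i i<m)) (next-closed (left i i<m)) (~-flip u~y) U u≢x

          rejoined : ∀ w → N (part i) s x w → y ~ w × σ′ w ≡ s × Witness σ′ w
          rejoined w Nw = let y~w , e = proj₂ R w Nw in
            y~w , e , neighbour-witness (minimal (suc m)) (moved-witness m) y~w
              (trans e (sym y-side))

          z-side : part i z ≡ s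
          z-side = same-side (mover-witness i) (stayer-witness i)
          y~z : y ~ z
          y~z = proj₁ (rejoined z (mover~stayer i , z-side))
          σ′z : σ′ z ≡ s
          σ′z = proj₁ (proj₂ (rejoined z (mover~stayer i , z-side)))
          Z′ : Witness σ′ z
          Z′ = proj₂ (proj₂ (rejoined z (mover~stayer i , z-side)))

          finish : suc i < m ⊎ suc i ≡ m → ⊥
          -- The return is made by the very next mover: `x` and `y` are both witnesses then, with
          -- the common neighbour `z` across.
          finish (inj₂ refl) = no-fork record
            { minimal = minimal m ; X = moved-witness i ; X′ = mover-witness m
            ; p≢p′ = ≢-sym (mover≢ i) ; p-low = mover-low i ; p′-low = mover-low m ; q-low = stayer-low i
            ; q-side = trans (part-off i (≢-sym (~⇒≢ (mover~stayer i))))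
                (trans z-side (sym (trans (cong not (part-at i)) (not-involutive s))))
            ; p~q = mover~stayer i ; p′~q = y~z }
          finish (inj₁ 1+i<m) = by-width (wide s)
            where
            τ : Fin n → Bool
            τ = part (suc i)
            x⁺ : Fin n
            x⁺ = mover (suc i)
            Xτ : Witness τ x
            Xτ = moved-witness i
            x≢x⁺ : x ≢ x⁺
            x≢x⁺ = ≢-sym (mover≢ i)
            τx : τ x ≡ not s
            τx = part-at i
            τx⁺ : τ x⁺ ≡ not s
            τx⁺ = trans (same-side Xτ (mover-witness (suc i))) τx
            stays⁺ : ∀ u → Witness τ u → u ≢ x⁺ → σ′ u ≡ not s
            stays⁺ u U u≢ = trans (proj₁ (next-stays (left (suc i) 1+i<m) u U u≢)) τx⁺

            by-width : 2 ≤ r (not s) ⊎ (2 ≤ r s × (∀ v → Low v)) → ⊥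
            -- After the return, `z` and a second former neighbour `z′` of `x` are witnesses, and
            -- `x` is still on the other side.
            by-width (inj₂ (2≤r , all-low))
              with #-pick≢ (N? (part i) s x)
                     (subst (2 ≤_) (sym (own-degree (minimal i) (mover-witness i) refl)) 2≤r) z
            ... | z′ , Nz′ , z′≢z = no-fork record
              { minimal = minimal (suc m) ; X = Z′ ; X′ = proj₂ (proj₂ (rejoined z′ Nz′))
              ; p≢p′ = ≢-sym z′≢z ; p-low = all-low _ ; p′-low = all-low _ ; q-low = all-low _
              ; q-side = trans (stays⁺ x Xτ x≢x⁺) (cong not (sym σ′z))
              ; p~q = ~-flip (mover~stayer i) ; p′~q = ~-flip (proj₁ Nz′) }
            -- The fork lies at stage `i`: witnesses `x` and `z`, with the following mover `x⁺` as
            -- common neighbour across.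
            by-width (inj₁ 2≤r) = no-fork record
              { minimal = minimal i ; X = mover-witness i ; X′ = stayer-witness i
              ; p≢p′ = ~⇒≢ (mover~stayer i) ; p-low = mover-low i ; p′-low = stayer-low i
              ; q-low = mover-low (suc i) ; q-side = trans (sym (part-off i (≢-sym x≢x⁺))) τx⁺
              ; p~q = x~x⁺ ; p′~q = proj₁ (proj₂ R₃ x⁺ (x~x⁺ , τx⁺)) }
              where
              τ₂ τ₃ : Fin n → Bool
              τ₂ = Flip σ′ z
              τ₃ = Flip (part i) z
              τ₂z : τ₂ z ≡ not s
              τ₂z = trans (↦-at σ′ z) (cong not σ′z)
              τ₃z : τ₃ z ≡ not s
              τ₃z = trans (↦-at (part i) z) (cong not z-side)
              min₂ : Minimal τ₂
              min₂ = flip-minimal (minimal (suc m)) Z′ (stayer-low i)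
              Z₂ : Witness τ₂ z
              Z₂ = witness-flip Z′
              stays₂ : ∀ u → Witness τ u → u ≢ x⁺ → τ₂ u ≡ not s × u ≢ z
              stays₂ u U u≢ = trans (↦-off σ′ u≢z) (stays⁺ u U u≢) , u≢z
                where
                u≢z : u ≢ z
                u≢z = ≢-sym (sides≢ {σ = σ′} σ′z (stays⁺ u U u≢))
              -- Moving `z` after the return attaches it, through `x`, to the component that `x⁺`
              -- left; so `z` takes the place of `x⁺`, whence `x ~ x⁺`.
              R₂ : (∀ w → N τ₂ (not s) z w → N τ (not s) x⁺ w) × (∀ w → N τ (not s) x⁺ w → N τ₂ (not s) z w)
              R₂ = replacement (minimal (suc i)) min₂ (mover-witness (suc i)) Z₂ τx⁺ τ₂z stays₂
                (λ u v U u≢ u~v e v≢z → let e′ = trans (sym (↦-off σ′ v≢z)) e in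
                  subst (λ t → τ v ≡ t × v ≢ x⁺) τx⁺ (next-closed (left (suc i) 1+i<m) u v U u≢ u~v
                    (trans e′ (sym τx⁺)) (≢-sym (sides≢ {σ = σ′} y-side e′))))
                (~-flip (mover~stayer i)) Xτ x≢x⁺
              x~x⁺ : x ~ x⁺
              x~x⁺ = ~-flip (proj₁ (proj₁ R₂ x (~-flip (mover~stayer i) , proj₁ (stays₂ x Xτ x≢x⁺))))
              another : ∃ λ w → N τ₂ (not s) z w × w ≢ x
              another = #-pick≢ (N? τ₂ (not s) z) (subst (2 ≤_) (sym (own-degree min₂ Z₂ τ₂z)) 2≤r) x
              b : Fin n
              b = proj₁ another
              Nb : N τ (not s) x⁺ b
              Nb = proj₁ R₂ b (proj₁ (proj₂ another))
              -- Had `z` moved at stage `i` instead of `x`, it would be attached through `b` to the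
              -- component that `x` entered; so `z` has the neighbours of `x` there, among them
              -- `x⁺`.
              R₃ : (∀ v → N τ₃ (not s) z v → N τ (not s) x v) × (∀ v → N τ (not s) x v → N τ₃ (not s) z v)
              R₃ = replacement (minimal (suc i)) (flip-minimal (minimal i) (stayer-witness i) (stayer-low i))
                Xτ (witness-flip (stayer-witness i)) τx τ₃z
                (λ v V v≢x → let e = trans (sym (part-off i v≢x)) (trans (same-side Xτ V) τx)
                                 v≢z = ≢-sym (sides≢ z-side e) in
                  trans (↦-off (part i) v≢z) e , v≢z)
                (λ u v _ _ _ e v≢z → let e′ = trans (sym (↦-off (part i) v≢z)) e
                                         v≢x = ≢-sym (sides≢ {σ = part i} refl e′) in
                  trans (part-off i v≢x) e′ , v≢x)
                (proj₁ (proj₁ (proj₂ another)))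
                (neighbour-witness (minimal (suc i)) (mover-witness (suc i)) (proj₁ Nb)
                  (trans (proj₂ Nb) (sym τx⁺)))
                (proj₂ (proj₂ another))

        -- By induction on `m`, using `no-return` to keep the mover from attaching itself to a
        -- component left earlier.
        left : ∀ m i → i < m → LeftAt i m
        left (suc m) i (s≤s i≤m) with m≤n⇒m<n∨m≡n i≤m
        ... | inj₂ refl = last-left m
        ... | inj₁ i<m  = record { stays = λ u U u≢x → proj₁ (stay u U u≢x) ; closed = closed ; quiet = quiet }
          where
          stay : ∀ u → Witness (part i) u → u ≢ mover i → part (suc m) u ≡ part i (mover i) × u ≢ mover m
          stay = next-stays (left m i i<m)
          closed : ∀ u v → Witness (part i) u → u ≢ mover i → u ~ v → part (suc m) v ≡ part i (mover i) →
                   part i v ≡ part i (mover i) × v ≢ mover i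
          closed u v U u≢x u~v e with v ≟ᶠ mover m
          ... | yes refl = ⊥-elim (no-return m (left m) i i<m u U u≢x u~v e)
          ... | no v≢y   = next-closed (left m i i<m) u v U u≢x u~v e v≢y
          quiet : ∀ u → Witness (part i) u → u ≢ mover i → ¬ Witness (part (suc m)) u
          -- A witness in the old component would, by `connected`, put `mover m` there too, but that
          -- was a witness before its move, when the component had none.
          quiet u U u≢x U′ = uncurry (Left.quiet (left m i i<m) (mover m))
            (connected (λ v → witness? (part i) v ×-dec ¬? (v ≟ᶠ mover i))
              (λ v w (V , v≢x) v~w e → let e′ , w≢x = closed v w V v≢x v~w (trans (sym e) (proj₁ (stay v V v≢x))) in
                neighbour-witness (minimal i) V v~w (trans e′ (sym (same-side (mover-witness i) V))) , w≢x)
              U′ (U , u≢x) (moved-witness m))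
            (mover-witness m)

        -- Two of the first `n + 1` moves have the same stayer. It lies in the component left by the
        -- earlier one, yet is a witness at the later one.
        impossible : ⊥
        impossible with pigeonhole (n<1+n n) (stayer ∘ toℕ)
        ... | a , b , a<b , eq = Left.quiet (left (toℕ b) (toℕ a) a<b) (stayer (toℕ a)) (stayer-witness (toℕ a))
          (≢-sym (~⇒≢ (mover~stayer (toℕ a)))) (subst (Witness (part (toℕ b))) (sym eq) (stayer-witness (toℕ b)))

      choose : ∀ σ v a → Minimal σ → Witness σ v → Move σ a
      choose σ v a minimal V with low-edge σ v minimal V
      ... | b , c , B , C , b-low , c-low , b~c with b ≟ᶠ a
      ...   | no b≢a = record { mover-witness = B ; stayer-witness = C ; mover-low = b-low
                              ; stayer-low = c-low ; mover~stayer = b~c ; mover≢ = b≢a }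
      ...   | yes refl = record { mover-witness = C ; stayer-witness = B ; mover-low = c-low
                                ; stayer-low = b-low ; mover~stayer = ~-flip b~c
                                ; mover≢ = ≢-sym (~⇒≢ b~c) }

      next : State → State
      next S = record
        { part     = Flip part mover
        ; previous = mover
        ; minimal  = minimal′
        ; move     = choose _ mover mover minimal′ (witness-flip mover-witness)
        }
        where
        open State S
        minimal′ : Minimal (Flip part mover)
        minimal′ = flip-minimal minimal mover-witness mover-low

      stage : State → ℕ → State
      stage start zero    = start
      stage start (suc i) = next (stage start i)

      trajectory : State → Trajectory
      trajectory start = record
        { part = S.part ; mover = S.mover ; stayer = S.stayer ; minimal = S.minimal
        ; mover-witness = S.mover-witness ; stayer-witness = S.stayer-witness
        ; mover-low = S.mover-low ; stayer-low = S.stayer-low ; mover~stayer = S.mover~stayer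
        ; mover≢ = λ i → S.mover≢ (suc i) ; part-suc = λ i → refl }
        where module S i = State (stage start i)

      bounce : ∀ σ v → ¬ Witness σ v
      bounce = minimal-suffices λ σ v minimal V → OnTrajectory.impossible
        (trajectory record { part = σ ; previous = v ; minimal = minimal ; move = choose σ v v minimal V })

-- Cliques and induced colourings

infixl 30 _∪｛_｝

_∪｛_｝ : Pred (Fin n) 0ℓ → Fin n → Pred (Fin n) 0ℓ
(P ∪｛ x ｝) u = u ≡ x ⊎ P u

_∪?_ : {P : Pred (Fin n) 0ℓ} → Decidable P → (x : Fin n) → Decidable (P ∪｛ x ｝)
(P? ∪? x) u = u ≟ᶠ x ⊎-dec P? u

#-insert : {P : Pred (Fin n) 0ℓ} (P? : Decidable P) (x : Fin n) → ¬ P x → # (P? ∪? x) ≡ suc (# P?)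
#-insert P? x ¬Px = trans (#-remove (P? ∪? x) x (inj₁ refl)) (cong suc (#-cong ((P? ∪? x) ∖? x) P?
  (λ { u (inj₁ e , ne) → contradiction e ne ; u (inj₂ p , _) → p })
  (λ u p → inj₂ p , λ { refl → ¬Px p })))

subset : {P : Pred (Fin n) 0ℓ} → Decidable P → Subset n
subset P? = tabulateᵛ (does ∘ P?)

∣subset∣ : {P : Pred (Fin n) 0ℓ} (P? : Decidable P) → ∣ subset P? ∣ ≡ # P?
∣subset∣ {zero}  P? = refl
∣subset∣ {suc n} P? with does (P? zero)
... | true  = cong suc (∣subset∣ (P? ∘ suc))
... | false = ∣subset∣ (P? ∘ suc)

∈subset⇒ : {P : Pred (Fin n) 0ℓ} (P? : Decidable P) → u ∈ subset P? → P u
∈subset⇒ {u = u} P? u∈ with P? u | trans (sym (lookup∘tabulate (does ∘ P?) u)) ([]=⇒lookup u∈)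
... | yes p | _ = p

#-∈ : (S : Subset n) → # (_∈? S) ≡ ∣ S ∣
#-∈ []          = refl
#-∈ (true ∷ S)  = cong suc (#-∈ S)
#-∈ (false ∷ S) = #-∈ S

clique : (G : Graph n) {P : Pred (Fin n) 0ℓ} (P? : Decidable P) → let open Graph G in
         (∀ u w → P u → P w → u ≢ w → u ~ w) → HasClique G (# P?)
clique G P? adjacent = subset P? , (λ u w u∈ w∈ → adjacent u w (∈subset⇒ P? u∈) (∈subset⇒ P? w∈)) , ∣subset∣ P?

-- Vertices outside `P` stay as isolated vertices, which avoids renumbering.
restrict : (G : Graph n) {P : Pred (Fin n) 0ℓ} → Decidable P → Graph n
restrict G {P} P? = record
  { _~_   = λ u w → P u × P w × u ~ w
  ; ~-sym = λ (p , q , e) → q , p , ~-sym G e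
  ; ~-irr = λ e (_ , _ , e′) → ~-irr G e e′
  ; _~?_  = λ u w → P? u ×-dec (P? w ×-dec (u ~? w))
  }
  where open Graph G using (_~_; _~?_)

module Split {n : ℕ} (G : Graph n) (r : Bool → ℕ) where
  open Partitions G r
  private
    k : ℕ
    k = r false + r true

  palette : ∀ s → Fin (r s) → Fin k
  palette false i = i ↑ˡ r true
  palette true  i = r false ↑ʳ i

  palette-injective : ∀ s {i j} → palette s i ≡ palette s j → i ≡ j
  palette-injective false e = ↑ˡ-injective (r true) _ _ e
  palette-injective true  e = ↑ʳ-injective (r false) _ _ e

  palette-disjoint : ∀ s t {i j} → palette s i ≡ palette t j → s ≡ t
  palette-disjoint false false e = refl
  palette-disjoint true  true  e = refl
  palette-disjoint false true {i} {j} e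
    with () ← trans (sym (splitAt-↑ˡ (r false) i (r true))) (trans (cong (splitAt (r false)) e) (splitAt-↑ʳ (r false) (r true) j))
  palette-disjoint true false {i} {j} e
    with () ← trans (sym (splitAt-↑ʳ (r false) (r true) i)) (trans (cong (splitAt (r false)) e) (splitAt-↑ˡ (r false) j (r true)))

  unsplit : {P : Pred (Fin n) 0ℓ} (σ : Fin n → Bool) → (∀ s → ∃ λ (c : Fin n → Fin (r s)) → ProperOn (λ u → σ u ≡ s × P u) c) →
            ∃ λ (c : Fin n → Fin k) → ProperOn P c
  unsplit σ f = (λ u → palette (σ u) (proj₁ (f (σ u)) u)) , λ u w Pu Pw u~w e →
    let e′ = palette-disjoint (σ u) (σ w) e in
    proj₂ (f (σ u)) u w (refl , Pu) (sym e′ , Pw) u~w (palette-injective (σ u)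
      (trans e (cong (λ s → palette s (proj₁ (f s) w)) (sym e′))))

  split : ∀ {P : Pred (Fin n) 0ℓ} → (∀ s → Fin (r s)) → (c : Fin n → Fin k) → ProperOn P c →
          ∃ λ (σ : Fin n → Bool) → ∀ s → ∃ λ (c : Fin n → Fin (r s)) → ProperOn (λ u → σ u ≡ s × P u) c
  split {P = P} default c proper = (λ u → side (splitAt (r false) (c u))) , λ s → (λ u → colour s (splitAt (r false) (c u))) ,
    λ u w (eu , Pu) (ew , Pw) u~w e → proper u w Pu Pw u~w
      (trans (sym (join-splitAt (r false) (r true) (c u))) (trans (cong (join (r false) (r true)) (same s _ _ eu ew e))
             (join-splitAt (r false) (r true) (c w))))
    where
    side : Fin (r false) ⊎ Fin (r true) → Bool
    side (inj₁ _) = false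
    side (inj₂ _) = true
    colour : ∀ s → Fin (r false) ⊎ Fin (r true) → Fin (r s)
    colour false (inj₁ i) = i
    colour true  (inj₂ i) = i
    -- The vertex is on the other side, where this colour is never compared.
    colour s     _        = default s
    same : ∀ s i j → side i ≡ s → side j ≡ s → colour s i ≡ colour s j → i ≡ j
    same false (inj₁ i) (inj₁ j) _ _ e = cong inj₁ e
    same true  (inj₂ i) (inj₂ j) _ _ e = cong inj₂ e

  uncolourable : ¬ Colourable G k → ∀ σ → ¬ SplitColouring σ
  uncolourable ¬col σ f with unsplit {P = λ _ → ⊤} σ (λ s → proj₁ (f s) , λ u w (e , _) (e′ , _) → proj₂ (f s) u w e e′)
  ... | c , proper = ¬col (c , λ u w → proper u w tt tt)

-- Brooks' theorem

module _ {n : ℕ} (G : Graph n) (k : ℕ) (2≤k : 2 ≤ k) (bound : ∀ v → degree G v ≤ suc k)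
         (¬col : ¬ Colourable G (suc k)) where
  private
    -- There are `k + 1` colours in total, so the degree bound makes every vertex low.
    r : Bool → ℕ
    r s = if s then k else 1
  open Partitions G r
  open Split G r
  open Uncolourable (uncolourable ¬col) (λ v → m≤n⇒m≤1+n (bound v))

  -- All neighbours of `p` are low, so all share its closed neighbourhood, which is therefore a
  -- clique.
  all-low-fork⇒clique : Fork → HasClique G (suc (suc k))
  all-low-fork⇒clique F = subst (HasClique G) size (clique G ((p ~?_) ∪? p) λ u w u∈ w∈ u≢w →
      adjacent u≢w (proj₁ (twin u u∈ w) w∈))
    where
    open Fork F
    adjacent : ∀ {u w} → u ≢ w → N[ u ] w → u ~ w
    adjacent u≢w (inj₁ w≡u) = contradiction (sym w≡u) u≢w
    adjacent u≢w (inj₂ u~w) = u~w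
    twin : ∀ u → N[ p ] u → p ≈ u
    twin u (inj₁ refl) = λ _ → id , id
    twin u (inj₂ p~u)  = low-twin F u (bound u) p~u
    size : # ((p ~?_) ∪? p) ≡ suc (suc k)
    size = trans (#-insert (p ~?_) p (λ p~p → ~⇒≢ p~p refl))
      (cong suc (trans (sym (degree≡# G p)) (low-witness-degree X p-low)))

  brooks-critical : ∀ v (c : Fin n → Fin (suc k)) → ProperOn (_≢ v) c → HasClique G (suc (suc k))
  brooks-critical v c proper = decidable-stable (hasClique? G (suc (suc k))) λ ¬clique →
    let σ , W = split (λ { false → zero ; true → fromℕ< (<-≤-trans z<s 2≤k) }) c proper in
    Bounce.bounce low-edge wide (¬clique ∘ all-low-fork⇒clique) σ v (witness W)
    where
    1≤r : ∀ s → 1 ≤ r s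
    1≤r false = ≤-refl
    1≤r true  = <⇒≤ 2≤k
    low-edge : ∀ σ v → Minimal σ → Witness σ v → ∃₂ λ p q → Witness σ p × Witness σ q × Low p × Low q × p ~ q
    low-edge σ v minimal W with #-pick (N? σ (σ v) v) (subst (1 ≤_) (sym (own-degree minimal W refl)) (1≤r (σ v)))
    ... | u , v~u , e = v , u , W , neighbour-witness minimal W v~u e , bound v , bound u , v~u
    wide : ∀ s → 2 ≤ r (not s) ⊎ (2 ≤ r s × (∀ v → Low v))
    wide false = inj₁ 2≤k
    -- The other side has a single colour, so the alternative with all vertices low is taken.
    wide true  = inj₂ (2≤k , bound)

-- Vertices are added one at a time. At the first prefix that cannot be coloured, deleting the last
-- vertex leaves a colourable graph, so the critical case yields a clique.
brooks : (G : Graph n) (k : ℕ) → 3 ≤ k → (∀ v → degree G v ≤ k) → ¬ Colourable G k → HasClique G (suc k)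
brooks {n} G (suc k) (s≤s 2≤k) bound ¬col = decidable-stable (hasClique? G (suc (suc k))) λ ¬clique →
  let c , proper = prefix ¬clique n ≤-refl in ¬col (c , λ u w → proper u w (toℕ<n u) (toℕ<n w))
  where
  open Colourings G
  prefix : ¬ HasClique G (suc (suc k)) → ∀ m → m ≤ n →
           ∃ λ (c : Fin n → Fin (suc k)) → ProperOn (λ u → toℕ u < m) c
  prefix ¬clique zero    _   = (λ _ → zero) , λ _ _ ()
  prefix ¬clique (suc m) m<n = decidable-stable (colourableOn? below? (suc k)) λ ¬col′ →
    let c , proper = prefix ¬clique m (<⇒≤ m<n)
        S , isClique , size = brooks-critical H k 2≤k H-bound
          (λ (c′ , proper′) → ¬col′ (c′ , λ u w u< w< u~w → proper′ u w (u< , w< , u~w)))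
          (fromℕ< m<n) c
          (λ u w u≢ w≢ (u< , w< , u~w) → proper u w (shrink u< u≢) (shrink w< w≢) u~w) in
    ¬clique (S , (λ u w u∈ w∈ u≢w → proj₂ (proj₂ (isClique u w u∈ w∈ u≢w))) , size)
    where
    below? : Decidable (λ (u : Fin n) → toℕ u < suc m)
    below? u = toℕ u <? suc m
    H : Graph n
    H = restrict G below?
    H-bound : ∀ v → degree H v ≤ suc k
    H-bound v = ≤-trans (≤-reflexive (degree≡# H v)) (≤-trans
      (#-mono (Graph._~?_ H v) (v ~?_) (λ u → proj₂ ∘ proj₂))
      (≤-trans (≤-reflexive (sym (degree≡# G v))) (bound v)))
    shrink : ∀ {u} → toℕ u < suc m → u ≢ fromℕ< m<n → toℕ u < m
    shrink (s≤s u≤m) u≢ = ≤∧≢⇒< u≤m λ e → u≢ (toℕ-injective (trans e (sym (toℕ-fromℕ< m<n))))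

-- Colouring around a vertex with many twins

module Extension {n : ℕ} (G : Graph n) {k : ℕ} (¬col : ¬ Colourable G k) (p : Fin n) (p-degree : degree G p ≤ k)
                 (c : Fin n → Fin k) (proper : Colourings.ProperOn G (_≢ p) c) where
  open Colourings G

  N[_] : Fin n → Pred (Fin n) 0ℓ
  N[ a ] w = w ≡ a ⊎ a ~ w

  all-colours : ∀ α → ∃ λ u → p ~ u × c u ≡ α
  all-colours α with any? (λ u → p ~? u ×-dec c u ≟ᶠ α)
  ... | yes found = found
  ... | no none   = contradiction
    (_ , λ u w → proper-extend {P = _≢ p} {Q = λ _ → ⊤} proper (λ _ _ u≢p → u≢p)
      (λ u _ u~p cu≡α → none (u , ~-flip u~p , cu≡α)) u w tt tt) ¬col

  distinct : ∀ {u w} → p ~ u → p ~ w → c u ≡ c w → u ≡ w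
  distinct = #-cover-injective (p ~?_) c (subst (_≤ k) (degree≡# G p) p-degree) all-colours

  -- Otherwise `a` could be recoloured `γ`, which would free its old colour for `p`.
  sees : ∀ {a} → p ~ a → ∀ γ → γ ≢ c a → ∃ λ u → a ~ u × u ≢ p × c u ≡ γ
  sees {a} p~a γ γ≢ with any? (λ u → a ~? u ×-dec (¬? (u ≟ᶠ p) ×-dec c u ≟ᶠ γ))
  ... | yes found = found
  ... | no none   = contradiction (_ , λ u w → recoloured u w tt tt) ¬col
    where
    recoloured : ProperOn (λ _ → ⊤) (c [ a ↦ γ ] [ p ↦ c a ])
    recoloured = proper-extend {P = _≢ p}
      (proper-extend {P = _≢ p} proper (λ _ q _ → q) (λ u u≢p u~a e → none (u , ~-flip u~a , u≢p , e)))
      (λ _ _ u≢p → u≢p) fresh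
      where
      fresh : ∀ u → ⊤ → u ~ p → (c [ a ↦ γ ]) u ≢ c a
      fresh u _ u~p e with u ≟ᶠ a
      ... | yes refl = γ≢ e
      ... | no u≢a   = u≢a (distinct (~-flip u~p) p~a e)

  -- The obstruction to giving `a` the colour of `l` once `l` has lost it.
  Repeated : Fin n → Fin n → Set
  Repeated a l = ∃ λ m → a ~ m × m ≢ l × m ≢ p × c m ≡ c l

  repeated? : ∀ a l → Dec (Repeated a l)
  repeated? a l = any? λ m → a ~? m ×-dec (¬? (m ≟ᶠ l) ×-dec (¬? (m ≟ᶠ p) ×-dec c m ≟ᶠ c l))

  -- Otherwise all k colours would occur on N[ a ] without p, m and m′, which has fewer than k elements.
  one-repeat : ∀ {a l l′} → degree G a ≤ suc k → p ~ a → p ~ l → p ~ l′ → a ~ l → a ~ l′ → l ≢ l′ →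
               Repeated a l → ¬ Repeated a l′
  one-repeat {a} {l} {l′} a-degree p~a p~l p~l′ a~l a~l′ l≢l′ (m , a~m , m≢l , m≢p , cm) (m′ , a~m′ , m′≢l′ , m′≢p , cm′) =
    <⇒≱ small (#-cover (((N? ∖? p) ∖? m) ∖? m′) c hit)
    where
    N? : Decidable N[ a ]
    N? = (a ~?_) ∪? a
    m≢m′ : m ≢ m′
    m≢m′ refl = l≢l′ (distinct p~l p~l′ (trans (sym cm) cm′))
    p∈ : N[ a ] p
    p∈ = inj₂ (~-flip p~a)
    m∈ : (N[ a ] ∖ p) m
    m∈ = inj₂ a~m , m≢p
    m′∈ : ((N[ a ] ∖ p) ∖ m) m′
    m′∈ = (inj₂ a~m′ , m′≢p) , ≢-sym m≢m′
    small : # (((N? ∖? p) ∖? m) ∖? m′) < k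
    small = s≤s⁻¹ (s≤s⁻¹ (begin
      suc (suc (suc (# (((N? ∖? p) ∖? m) ∖? m′)))) ≡⟨ cong (2 +_) (#-remove ((N? ∖? p) ∖? m) m′ m′∈) ⟨
      suc (suc (# ((N? ∖? p) ∖? m)))               ≡⟨ cong suc (#-remove (N? ∖? p) m m∈) ⟨
      suc (# (N? ∖? p))                            ≡⟨ #-remove N? p p∈ ⟨
      # N?                                         ≡⟨ #-insert (a ~?_) a (λ a~a → ~⇒≢ a~a refl) ⟩
      suc (# (a ~?_))                              ≡⟨ cong suc (degree≡# G a) ⟨
      suc (degree G a)                             ≤⟨ s≤s a-degree ⟩
      suc (suc k)                                  ∎))
      where open ≤-Reasoning
    hit : ∀ α → ∃ λ u → (((N[ a ] ∖ p) ∖ m) ∖ m′) u × c u ≡ α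
    hit α with α ≟ᶠ c a
    ... | yes refl = a , (((inj₁ refl , ≢-sym (~⇒≢ p~a)) , ~⇒≢ a~m) , ~⇒≢ a~m′) , refl
    ... | no α≢ with sees p~a α α≢
    ...   | u , a~u , u≢p , refl with u ≟ᶠ m | u ≟ᶠ m′
    -- The colours of `m` and `m′` survive the removal at `l` and `l′`.
    ...     | yes refl | _ = l , (((inj₂ a~l , ≢-sym (~⇒≢ p~l)) , ≢-sym m≢l) ,
                λ { refl → l≢l′ (distinct p~l p~l′ cm′) }) , sym cm
    ...     | no _ | yes refl = l′ , (((inj₂ a~l′ , ≢-sym (~⇒≢ p~l′)) ,
                λ { refl → l≢l′ (sym (distinct p~l′ p~l cm)) }) , ≢-sym m′≢l′) , sym cm′
    ...     | no u≢m | no u≢m′ = u , (((inj₂ a~u , u≢p) , u≢m) , u≢m′) , refl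

  -- Give a and b the colour of l, give l the old colour of a and p the old colour of b.
  must-repeat : ∀ {a b l} → p ~ a → p ~ b → a ≢ b → ¬ a ~ b → p ~ l → l ~ a → l ~ b →
                (∀ u → u ≢ p → l ~ u → p ~ u) → ¬ Repeated a l → ¬ Repeated b l → ⊥
  must-repeat {a} {b} {l} p~a p~b a≢b a≁b p~l l~a l~b twin no-a no-b = ¬col (_ , λ u w → proper₄ u w tt tt)
    where
    c₁ c₂ c₃ : Fin n → Fin k
    c₁ = c [ a ↦ c l ]
    c₂ = c₁ [ b ↦ c l ]
    c₃ = c₂ [ l ↦ c a ]
    l≢a : l ≢ a
    l≢a = ~⇒≢ l~a
    proper₁ : ProperOn (λ u → u ≢ p × u ≢ l × u ≢ b) c₁
    proper₁ = proper-extend {P = _≢ p} proper (λ u (u≢p , _) _ → u≢p)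
      λ u (u≢p , u≢l , _) u~a e → no-a (u , ~-flip u~a , u≢l , u≢p , e)
    proper₂ : ProperOn (λ u → u ≢ p × u ≢ l) c₂
    proper₂ = proper-extend {P = λ u → u ≢ p × u ≢ l × u ≢ b} proper₁ (λ u (u≢p , u≢l) u≢b → u≢p , u≢l , u≢b)
      λ u (u≢p , u≢l) u~b e → no-b (u , ~-flip u~b , u≢l , u≢p ,
        trans (sym (↦-off c λ { refl → a≁b u~b })) e)
    proper₃ : ProperOn (_≢ p) c₃
    proper₃ = proper-extend {P = λ u → u ≢ p × u ≢ l} proper₂ (λ u → _,_) fresh
      where
      fresh : ∀ u → u ≢ p → u ~ l → c₂ u ≢ c a
      fresh u u≢p u~l e with u ≟ᶠ b | u ≟ᶠ a
      ... | yes refl | _        = l≢a (distinct p~l p~a e)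
      ... | no _     | yes refl = l≢a (distinct p~l p~a e)
      ... | no _     | no u≢a   = u≢a (distinct (twin u u≢p (~-flip u~l)) p~a e)
    proper₄ : ProperOn (λ _ → ⊤) (c₃ [ p ↦ c b ])
    proper₄ = proper-extend {P = _≢ p} proper₃ (λ _ _ u≢p → u≢p) fresh
      where
      fresh : ∀ u → ⊤ → u ~ p → c₃ u ≢ c b
      fresh u _ u~p e with u ≟ᶠ l | u ≟ᶠ b | u ≟ᶠ a
      ... | yes refl | _        | _        = a≢b (distinct p~a p~b e)
      ... | no _     | yes refl | _        = ~⇒≢ l~b (distinct p~l p~b e)
      ... | no _     | no _     | yes refl = ~⇒≢ l~b (distinct p~l p~b e)
      ... | no _     | no u≢b   | no _     = u≢b (distinct (~-flip u~p) p~b e)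

  -- Members of `L` are adjacent to every other neighbour of `p`, so non-adjacent `a` and `b` lie
  -- outside `L`. Each of three members would then be repeated at `a` or at `b`, but each of these
  -- admits only one.
  three-twins : ∀ {L : Pred (Fin n) 0ℓ} (L? : Decidable L) → 3 ≤ # L? →
    (∀ l → L l → p ~ l × (∀ u → (N[ p ] u → N[ l ] u) × (N[ l ] u → N[ p ] u))) →
    (∀ a → p ~ a → ¬ L a → degree G a ≤ suc k) →
    ∀ a b → p ~ a → p ~ b → a ≢ b → a ~ b
  three-twins {L} L? 3≤ twin high a b p~a p~b a≢b = decidable-stable (a ~? b) λ a≁b →
    let nL : ∀ {x y} → p ~ x → p ~ y → x ≢ y → ¬ x ~ y → ¬ L x
        nL p~x p~y x≢y x≁y Lx = [ (λ e → x≢y (sym e)) , x≁y ]′ (proj₁ (proj₂ (twin _ Lx) _) (inj₂ p~y))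
        ¬La = nL p~a p~b a≢b a≁b
        ¬Lb = nL p~b p~a (≢-sym a≢b) (a≁b ∘ ~-flip)
        to : ∀ {x l} → p ~ x → ¬ L x → L l → l ~ x
        to p~x ¬Lx Ll = [ (λ { refl → contradiction Ll ¬Lx }) , id ]′ (proj₁ (proj₂ (twin _ Ll) _) (inj₂ p~x))
        either : ∀ l → L l → Repeated a l ⊎ Repeated b l
        either l Ll = classify (repeated? a l) (repeated? b l) λ no-a no-b →
          must-repeat p~a p~b a≢b a≁b (proj₁ (twin l Ll)) (to p~a ¬La Ll) (to p~b ¬Lb Ll)
            (λ u u≢p l~u → [ (λ u≡p → contradiction u≡p u≢p) , id ]′ (proj₂ (proj₂ (twin l Ll) u) (inj₂ l~u)))
            no-a no-b
        once : ∀ {x l l′} → p ~ x → ¬ L x → L l → L l′ → l ≢ l′ → Repeated x l → ¬ Repeated x l′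
        once p~x ¬Lx Ll Ll′ = one-repeat (high _ p~x ¬Lx) p~x (proj₁ (twin _ Ll)) (proj₁ (twin _ Ll′))
          (~-flip (to p~x ¬Lx Ll)) (~-flip (to p~x ¬Lx Ll′))
        (l₁ , L₁) = #-pick L? (≤-trans (s≤s z≤n) 3≤)
        2≤ = s≤s⁻¹ (≤-trans 3≤ (#-remove-≤ L? l₁))
        (l₂ , L₂ , l₂≢l₁) = #-pick (L? ∖? l₁) (<⇒≤ 2≤)
        (l₃ , (L₃ , l₃≢l₁) , l₃≢l₂) = #-pick≢ (L? ∖? l₁) 2≤ l₂
    in pigeon (once p~a ¬La L₁ L₂ (≢-sym l₂≢l₁)) (once p~a ¬La L₁ L₃ (≢-sym l₃≢l₁)) (once p~a ¬La L₂ L₃ (≢-sym l₃≢l₂))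
              (once p~b ¬Lb L₁ L₂ (≢-sym l₂≢l₁)) (once p~b ¬Lb L₁ L₃ (≢-sym l₃≢l₁)) (once p~b ¬Lb L₂ L₃ (≢-sym l₃≢l₂))
              (either l₁ L₁) (either l₂ L₂) (either l₃ L₃)
    where
    classify : ∀ {A B : Set} → Dec A → Dec B → (¬ A → ¬ B → ⊥) → A ⊎ B
    classify (yes a) _       _ = inj₁ a
    classify (no _)  (yes b) _ = inj₂ b
    classify (no ¬a) (no ¬b) f = ⊥-elim (f ¬a ¬b)
    pigeon : ∀ {A₁ A₂ A₃ B₁ B₂ B₃ : Set} → (A₁ → ¬ A₂) → (A₁ → ¬ A₃) → (A₂ → ¬ A₃) →
             (B₁ → ¬ B₂) → (B₁ → ¬ B₃) → (B₂ → ¬ B₃) → A₁ ⊎ B₁ → A₂ ⊎ B₂ → A₃ ⊎ B₃ → ⊥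
    pigeon a₁₂ a₁₃ a₂₃ b₁₂ b₁₃ b₂₃ (inj₁ x) (inj₁ y) _        = a₁₂ x y
    pigeon a₁₂ a₁₃ a₂₃ b₁₂ b₁₃ b₂₃ (inj₁ x) (inj₂ y) (inj₁ z) = a₁₃ x z
    pigeon a₁₂ a₁₃ a₂₃ b₁₂ b₁₃ b₂₃ (inj₁ x) (inj₂ y) (inj₂ z) = b₂₃ y z
    pigeon a₁₂ a₁₃ a₂₃ b₁₂ b₁₃ b₂₃ (inj₂ x) (inj₂ y) _        = b₁₂ x y
    pigeon a₁₂ a₁₃ a₂₃ b₁₂ b₁₃ b₂₃ (inj₂ x) (inj₁ y) (inj₁ z) = a₂₃ y z
    pigeon a₁₂ a₁₃ a₂₃ b₁₂ b₁₃ b₂₃ (inj₂ x) (inj₁ y) (inj₂ z) = b₁₃ x z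

-- Small cliques of high vertices

module SmallHighCliques
  {n : ℕ} (G : Graph n) (r : Bool → ℕ) (t : ℕ)
  (¬col : ¬ Colourable G (r false + r true))
  (bounded : ∀ v → degree G v ≤ suc (r false + r true))
  (high-clique : ∀ {P : Pred (Fin n) 0ℓ} (P? : Decidable P) →
     (∀ u w → P u → P w → u ≢ w → Graph._~_ G u w) → (∀ u → P u → r false + r true < degree G u) → # P? ≤ t)
  (2≤r : ∀ s → 2 ≤ r s)
  (t<r : ∀ s → t < r s)
  (3+2t≤k : 3 + (t + t) ≤ r false + r true)
  where

  open Partitions G r
  open Split G r
  open Uncolourable (uncolourable ¬col) bounded

  private
    k : ℕ
    k = r false + r true
    variable
      σ : Fin n → Bool

  -- Such a colouring, combined with the one that omits `v` on the rest of the side, would colour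
  -- everything.
  component-uncolourable : Minimal σ → Witness σ v → (c : Fin n → Fin (r (σ v))) → ¬ ProperOn (Witness σ) c
  component-uncolourable {σ = σ} {v = v} minimal V c proper = uncolourable ¬col σ split′
    where
    open Witness V
    split′ : SplitColouring σ
    split′ s with s ≟ᵇ σ v
    ... | yes refl = _ , merge (witness? σ)
            (λ u w (_ , U) (_ , W) → proper u w U W)
            (λ u w (e , ¬U) (e′ , ¬W) → proj₂ (colouring s) u w (e , λ { refl → ¬U V }) (e′ , λ { refl → ¬W V }))
            (λ u w e e′ U u~w → neighbour-witness minimal U u~w (trans e′ (sym e)))
    ... | no s≢ = proj₁ (colouring s) , λ u w e e′ → proj₂ (colouring s) u w
            (e , λ { refl → s≢ (sym e) }) (e′ , λ { refl → s≢ (sym e′) })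

  -- The graph on the witnesses has maximum degree at most `r s` and no colouring with `r s`
  -- colours, so Brooks' theorem gives a clique of `r s + 1` of them. It fills its component, which
  -- contains all witnesses.
  component-clique : Minimal σ → Witness σ v → 3 ≤ r (σ v) → Witness σ u → Witness σ w → u ≢ w → u ~ w
  component-clique {σ = σ} {v = v} {u = u₀} {w = w₀} minimal V 3≤ U₀ W₀ u₀≢w₀ =
    conclude (brooks H (r s) 3≤ H-bound λ (c , proper) →
      component-uncolourable minimal V c λ u w U W u~w → proper u w (U , W , u~w))
    where
    s : Bool
    s = σ v
    H : Graph n
    H = restrict G (witness? σ)
    H-bound : ∀ u → degree H u ≤ r s
    H-bound u = ≤-trans (≤-reflexive (degree≡# H u)) (cases (witness? σ u))
      where
      cases : Dec (Witness σ u) → # (Graph._~?_ H u) ≤ r s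
      cases (yes U) = ≤-trans
        (#-mono (Graph._~?_ H u) (N? σ s u) (λ w (_ , W , u~w) → u~w , same-side V W))
        (≤-reflexive (own-degree minimal U (same-side V U)))
      cases (no ¬U) = ≤-trans
        (#-mono (Graph._~?_ H u) (N? σ s v) (λ w (U , _) → contradiction U ¬U))
        (≤-reflexive (own-degree minimal V refl))
    conclude : HasClique H (suc (r s)) → u₀ ~ w₀
    conclude (S , isClique , ∣S∣) = proj₂ (proj₂ (isClique u₀ w₀ (all∈ U₀) (all∈ W₀) u₀≢w₀))
      where
      size : # (_∈? S) ≡ suc (r s)
      size = trans (#-∈ S) ∣S∣
      member-witness : ∀ {u} → u ∈ S → Witness σ u
      member-witness {u} u∈ with #-pick≢ (_∈? S) (subst (2 ≤_) (sym size) (s≤s (≤-trans (s≤s z≤n) 3≤))) u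
      ... | w , w∈ , w≢u = proj₁ (isClique u w u∈ w∈ (≢-sym w≢u))
      -- The other `r s` members already account for all neighbours of `u` on its side.
      closed : ∀ u w → u ∈ S → u ~ w → σ u ≡ σ w → w ∈ S
      closed u w u∈ u~w e = #-tight (_∈? S) (N? σ s u ∪? u) within
        (≤-reflexive (trans (#-insert (N? σ s u) u (λ (u~u , _) → ~⇒≢ u~u refl))
          (trans (cong suc (own-degree minimal (member-witness u∈) σu)) (sym size))))
        w (inj₂ (u~w , trans (sym e) σu))
        where
        σu : σ u ≡ s
        σu = same-side V (member-witness u∈)
        within : ∀ w → w ∈ S → (N σ s u ∪｛ u ｝) w
        within w w∈ with w ≟ᶠ u
        ... | yes e = inj₁ e
        ... | no w≢u = let _ , W , u~w = isClique u w u∈ w∈ (≢-sym w≢u) in inj₂ (u~w , same-side V W)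
      all∈ : ∀ {w} → Witness σ w → w ∈ S
      all∈ W with #-pick (_∈? S) (subst (1 ≤_) (sym size) (s≤s z≤n))
      ... | u , u∈ = connected (_∈? S) closed (member-witness u∈) u∈ W

  -- With at least three colours, `v` and its neighbours on its side form a clique of `r s + 1`
  -- vertices, at most `t < r s` of them high, so two are low. With two colours, `t` is at most 1,
  -- and without a low edge the division into low and high would be a proper colouring.
  low-edge : ∀ σ v → Minimal σ → Witness σ v → ∃₂ λ p q → Witness σ p × Witness σ q × Low p × Low q × p ~ q
  low-edge σ v minimal V with 3 ≤? r (σ v)
  ... | yes 3≤ = let
      (a , (A , a-low)) = #-pick L? (≤-trans (s≤s z≤n) 2≤L)
      (b , (B , b-low) , b≢a) = #-pick≢ L? 2≤L a
    in a , b , star-witness A , star-witness B , a-low , b-low ,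
       component-clique minimal V 3≤ (star-witness A) (star-witness B) (≢-sym b≢a)
    where
    s : Bool
    s = σ v
    Star? : Decidable (N σ s v ∪｛ v ｝)
    Star? = N? σ s v ∪? v
    star-witness : ∀ {u} → (N σ s v ∪｛ v ｝) u → Witness σ u
    star-witness (inj₁ refl)       = V
    star-witness (inj₂ (v~u , e)) = neighbour-witness minimal V v~u e
    L? : Decidable (λ u → (N σ s v ∪｛ v ｝) u × Low u)
    L? u = Star? u ×-dec low? u
    H? : Decidable (λ u → (N σ s v ∪｛ v ｝) u × ¬ Low u)
    H? u = Star? u ×-dec ¬? (low? u)
    2≤L : 2 ≤ # L?
    2≤L = +-cancelʳ-≤ (# H?) 2 (# L?) (begin
      2 + # H?        ≤⟨ s≤s (≤-trans (s≤s (high-clique H?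
                           (λ u w (A , _) (B , _) → component-clique minimal V 3≤ (star-witness A) (star-witness B))
                           (λ u → ≰⇒> ∘ proj₂))) (t<r s)) ⟩
      suc (r s)       ≡⟨ cong suc (own-degree minimal V refl) ⟨
      suc (d σ s v)   ≡⟨ #-insert (N? σ s v) v (λ (v~v , _) → ~⇒≢ v~v refl) ⟨
      # Star?         ≡⟨ #-split Star? low? ⟩
      # L? + # H?     ∎)
      where open ≤-Reasoning
  ... | no 3≰ with any? (λ p → any? λ q → witness? σ p ×-dec (witness? σ q ×-dec (low? p ×-dec (low? q ×-dec p ~? q))))
  ...   | yes found = found
  ...   | no none = ⊥-elim (component-uncolourable minimal V c proper)
    where
    t≤1 : t ≤ 1
    t≤1 = s≤s⁻¹ (≤-trans (t<r (σ v)) (s≤s⁻¹ (≰⇒> 3≰)))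
    α β : Fin (r (σ v))
    α = fromℕ< (<-≤-trans z<s (2≤r (σ v)))
    β = fromℕ< (2≤r (σ v))
    α≢β : α ≢ β
    α≢β e = contradiction (trans (sym (toℕ-fromℕ< (<-≤-trans z<s (2≤r (σ v)))))
      (trans (cong toℕ e) (toℕ-fromℕ< (2≤r (σ v))))) λ ()
    -- Proper on the witnesses, as neither two low nor two high ones are adjacent here.
    c : Fin n → Fin (r (σ v))
    c u = if does (low? u) then α else β
    high-edge : ∀ {u w} → ¬ Low u → ¬ Low w → u ~ w → ⊥
    high-edge {u} {w} u-high w-high u~w = <⇒≱ (s≤s t≤1) (≤-trans pair
      (high-clique ((_≟ᶠ w) ∪? u)
        (λ { x y (inj₁ refl) (inj₁ refl) ne → contradiction refl ne
           ; x y (inj₁ refl) (inj₂ refl) _ → u~w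
           ; x y (inj₂ refl) (inj₁ refl) _ → ~-flip u~w
           ; x y (inj₂ refl) (inj₂ refl) ne → contradiction refl ne })
        λ { x (inj₁ refl) → ≰⇒> u-high ; x (inj₂ refl) → ≰⇒> w-high }))
      where
      pair : 2 ≤ # ((_≟ᶠ w) ∪? u)
      pair = ≤-trans (s≤s (≤-trans (s≤s z≤n) (≤-reflexive (sym (#-remove (_≟ᶠ w) w refl)))))
        (≤-reflexive (sym (#-insert (_≟ᶠ w) u (~⇒≢ u~w))))
    c-low : ∀ {u} → Low u → c u ≡ α
    c-low {u} l = cong (if_then α else β) (dec-true (low? u) l)
    c-high : ∀ {u} → ¬ Low u → c u ≡ β
    c-high {u} h = cong (if_then α else β) (dec-false (low? u) h)
    proper : ProperOn (Witness σ) c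
    proper u w U W u~w e = cases (low? u) (low? w)
      where
      cases : Dec (Low u) → Dec (Low w) → ⊥
      cases (yes lu) (yes lw) = none (u , w , U , W , lu , lw , u~w)
      cases (yes lu) (no hw)  = α≢β (trans (sym (c-low lu)) (trans e (c-high hw)))
      cases (no hu)  (yes lw) = α≢β (trans (sym (c-low lw)) (trans (sym e) (c-high hu)))
      cases (no hu)  (no hw)  = high-edge hu hw u~w

  -- When the side has two colours, `p` has just two neighbours on it, one of them its twin `p′`.
  fork-clique : (F : Fork) → let open Fork F in
                ∀ u w → N π (π p) p u → N π (π p) p w → u ≢ w → u ~ w
  fork-clique F u w Nu@(p~u , eu) Nw@(p~w , ew) u≢w with 3 ≤? r (Fork.π F (Fork.p F))
  ... | yes 3≤ = component-clique minimal X 3≤ (neighbour-witness minimal X p~u eu)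
                   (neighbour-witness minimal X p~w ew) u≢w
    where open Fork F
  ... | no 3≰ with u ≟ᶠ Fork.p′ F | w ≟ᶠ Fork.p′ F
  ...   | yes refl | _ = [ (λ e → contradiction (sym e) u≢w) , id ]′ (proj₁ (fork-p≈p′ F w) (inj₂ p~w))
  ...   | no _ | yes refl = [ (λ e → contradiction e u≢w) , ~-flip ]′ (proj₁ (fork-p≈p′ F u) (inj₂ p~u))
  ...   | no u≢p′ | no w≢p′ = contradiction (begin
      3                                                   ≤⟨ s≤s (s≤s (s≤s z≤n)) ⟩
      suc (suc (suc (# (((N? π (π p) p ∖? u) ∖? w) ∖? p′)))) ≡⟨ cong (2 +_) (#-remove ((N? π (π p) p ∖? u) ∖? w) p′ ((p~p′ , ≢-sym u≢p′) , ≢-sym w≢p′)) ⟨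
      suc (suc (# ((N? π (π p) p ∖? u) ∖? w)))            ≡⟨ cong suc (#-remove (N? π (π p) p ∖? u) w (Nw , ≢-sym u≢w)) ⟨
      suc (# (N? π (π p) p ∖? u))                         ≡⟨ #-remove (N? π (π p) p) u Nu ⟨
      d π (π p) p                                         ≡⟨ own-degree minimal X refl ⟩
      r (π p)                                             ∎) 3≰
    where
    open Fork F
    open ≤-Reasoning
    p~p′ : N π (π p) p p′
    p~p′ = [ (λ e → contradiction (sym e) p≢p′) , id ]′ (proj₂ (fork-side F p′ (same-side X X′)) (~-flip p′~q))
         , same-side X X′

  -- On each side the high neighbours of `p` form a clique, so at most `2t` of its `k` neighbours
  -- are high. At least three are low, hence twins of `p`, and `three-twins` applies.
  fork⇒clique : Fork → HasClique G (suc k)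
  fork⇒clique F = subst (HasClique G) size (clique G ((p ~?_) ∪? p) adjacent)
    where
    open Fork F
    size : # ((p ~?_) ∪? p) ≡ suc k
    size = trans (#-insert (p ~?_) p (λ p~p → ~⇒≢ p~p refl))
      (cong suc (trans (sym (degree≡# G p)) (low-witness-degree X p-low)))
    L? : Decidable (λ u → p ~ u × Low u)
    L? u = p ~? u ×-dec low? u
    H? : Decidable (λ u → p ~ u × ¬ Low u)
    H? u = p ~? u ×-dec ¬? (low? u)
    few-high : # H? ≤ t + t
    few-high = ≤-trans (≤-reflexive (#-split H? (λ u → π u ≟ᵇ π p))) (+-mono-≤
      (high-clique (λ u → H? u ×-dec π u ≟ᵇ π p)
        (λ u w ((p~u , _) , eu) ((p~w , _) , ew) → fork-clique F u w (p~u , eu) (p~w , ew))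
        (λ u ((_ , h) , _) → ≰⇒> h))
      (high-clique (λ u → H? u ×-dec ¬? (π u ≟ᵇ π p))
        -- After the shift `p` lies on the other side, so its neighbours there are covered as well.
        (λ u w ((p~u , _) , eu) ((p~w , _) , ew) → fork-clique (fork-shift F) u w (p~u , flipped eu) (p~w , flipped ew))
        (λ u ((_ , h) , _) → ≰⇒> h)))
      where
      flipped : ∀ {u} → π u ≢ π p → Flip π p u ≡ Flip π p p
      flipped ne = trans (↦-off π λ { refl → ne refl }) (trans (¬-not ne) (sym (↦-at π p)))
    3≤L : 3 ≤ # L?
    3≤L = +-cancelʳ-≤ (# H?) 3 (# L?) (begin
      3 + # H?       ≤⟨ +-monoʳ-≤ 3 few-high ⟩
      3 + (t + t)    ≤⟨ 3+2t≤k ⟩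
      k              ≡⟨ low-witness-degree X p-low ⟨
      degree G p     ≡⟨ degree≡# G p ⟩
      # (p ~?_)      ≡⟨ #-split (p ~?_) low? ⟩
      # L? + # H?    ∎)
      where open ≤-Reasoning
    adjacent : ∀ u w → ((p ~_) ∪｛ p ｝) u → ((p ~_) ∪｛ p ｝) w → u ≢ w → u ~ w
    adjacent u w (inj₁ refl) (inj₁ refl) ne = contradiction refl ne
    adjacent u w (inj₁ refl) (inj₂ p~w)  _  = p~w
    adjacent u w (inj₂ p~u)  (inj₁ refl) _  = ~-flip p~u
    adjacent u w (inj₂ p~u)  (inj₂ p~w)  ne =
      Extension.three-twins G ¬col p p-low (proj₁ pc) (proj₂ pc) L? 3≤L
        (λ l (p~l , l-low) → p~l , low-twin F l l-low p~l)
        (λ a _ _ → bounded a) u w p~u p~w ne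
      where
      pc : ∃ λ (c : Fin n → Fin k) → ProperOn (_≢ p) c
      pc = unsplit π (Witness.colouring X)

  high-cliques-brooks : ∀ v (c : Fin n → Fin k) → ProperOn (_≢ v) c → HasClique G (suc k)
  high-cliques-brooks v c proper = decidable-stable (hasClique? G (suc k)) λ ¬clique →
    let σ , W = split (λ s → fromℕ< (<-≤-trans z<s (2≤r s))) c proper in
    Bounce.bounce low-edge (λ s → inj₁ (2≤r (not s))) (¬clique ∘ fork⇒clique) σ v (witness W)

-- From the chromatic and clique numbers to colourings and cliques

lookup-injective : {A : Set} {xs : List A} → Unique xs → ∀ {i j} → lookup xs i ≡ lookup xs j → i ≡ j
lookup-injective (_ ∷ _)       {zero}  {zero}  e = refl
lookup-injective (x∉xs ∷ _)    {zero}  {suc j} e = contradiction e (lookupᴬ x∉xs (∈-lookup j))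
lookup-injective (x∉xs ∷ _)    {suc i} {zero}  e = contradiction (sym e) (lookupᴬ x∉xs (∈-lookup i))
lookup-injective (_ ∷ unique)  {suc i} {suc j} e = cong suc (lookup-injective unique e)

#-injective : ∀ {k} {P : Pred (Fin n) 0ℓ} (P? : Decidable P) (c : Fin n → Fin k) →
              (∀ {u w} → P u → P w → c u ≡ c w → u ≡ w) → # P? ≤ k
#-injective {n} {k} {P} P? c inj = subst (_≤ k) (length-filter-tabulate P? id)
  (injective⇒≤ {f = c ∘ lookup xs} λ {i} {j} e →
    lookup-injective (filter⁺ P? (allFin⁺ n)) (inj (holds i) (holds j) e))
  where
  xs : List (Fin n)
  xs = filter P? (allFin n)
  holds : ∀ i → P (lookup xs i)
  holds i = lookupᴬ (all-filter P? (allFin n)) (∈-lookup i)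

#-lookup : {P : Pred (Fin n) 0ℓ} (P? : Decidable P) (xs : List (Fin n)) →
           # (λ i → P? (lookup xs i)) ≡ length (filter P? xs)
#-lookup P? []       = refl
#-lookup P? (x ∷ xs) with P? x
... | yes _ = cong suc (#-lookup P? xs)
... | no _  = #-lookup P? xs

filter-filter : {P Q : Pred (Fin n) 0ℓ} (P? : Decidable P) (Q? : Decidable Q) → (∀ u → P u → Q u) → ∀ xs →
                length (filter P? (filter Q? xs)) ≡ length (filter P? xs)
filter-filter P? Q? P⊆Q [] = refl
filter-filter P? Q? P⊆Q (x ∷ xs) with Q? x
filter-filter P? Q? P⊆Q (x ∷ xs) | no ¬q with P? x
... | yes p = contradiction (P⊆Q x p) ¬q
... | no _  = filter-filter P? Q? P⊆Q xs
filter-filter P? Q? P⊆Q (x ∷ xs) | yes _ with P? x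
... | yes _ = cong suc (filter-filter P? Q? P⊆Q xs)
... | no _  = filter-filter P? Q? P⊆Q xs

induced-clique : (G : Graph n) {Q : Pred (Fin n) 0ℓ} (Q? : Decidable Q) {P : Pred (Fin n) 0ℓ} (P? : Decidable P) →
                 (∀ u → P u → Q u) → (let open Graph G in ∀ u w → P u → P w → u ≢ w → u ~ w) →
                 HasClique (induced G Q?) (# P?)
induced-clique {n} G Q? P? P⊆Q adjacent = subst (HasClique (induced G Q?)) size
  (clique (induced G Q?) (λ i → P? (lookup xs i)) λ i j Pi Pj i≢j →
    adjacent _ _ Pi Pj (i≢j ∘ lookup-injective (filter⁺ Q? (allFin⁺ n))))
  where
  xs : List (Fin n)
  xs = filter Q? (allFin n)
  size : # (λ i → P? (lookup xs i)) ≡ # P?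
  size = trans (#-lookup P? xs) (trans (filter-filter P? Q? P⊆Q (allFin n)) (length-filter-tabulate P? id))

lift-colouring : (G : Graph n) {P : Pred (Fin n) 0ℓ} (P? : Decidable P) → ∀ {j k} → j ≤ suc k →
                 Colourable (induced G P?) j →
                 ∃ λ (c : Fin n → Fin (suc k)) → Colourings.ProperOn G P c
lift-colouring {n} G {P} P? {j} {k} j≤ (c , proper) = (λ u → colour u (P? u)) , λ u w Pu Pw → go u w (P? u) (P? w) Pu Pw
  where
  open Graph G using (_~_)
  position : ∀ u → P u → Fin (length (filter P? (allFin n)))
  position u Pu = index (∈-filter⁺ P? (∈-allFin u) Pu)
  at : ∀ u (Pu : P u) → u ≡ lookup (filter P? (allFin n)) (position u Pu)
  at u Pu = lookup-index (∈-filter⁺ P? (∈-allFin u) Pu)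
  colour : ∀ u → Dec (P u) → Fin (suc k)
  colour u (yes Pu) = inject≤ (c (position u Pu)) j≤
  -- An arbitrary colour outside `P`; `suc k` ensures that there is one.
  colour u (no _)   = zero
  go : ∀ u w (du : Dec (P u)) (dw : Dec (P w)) → P u → P w → u ~ w → colour u du ≢ colour w dw
  go u w (no ¬Pu) _ Pu _ _ = contradiction Pu ¬Pu
  go u w (yes _) (no ¬Pw) _ Pw _ = contradiction Pw ¬Pw
  go u w (yes Pu) (yes Pw) _ _ u~w e = proper (position u Pu) (position w Pw)
    (subst₂ _~_ (at u Pu) (at w Pw) u~w) (inject≤-injective _ _ _ _ e)

degree≤Δ : (G : Graph n) (v : Fin n) → degree G v ≤ Δ G
degree≤Δ {n} G v = lookupᴬ (xs≤max 0 (map (degree G) (allFin n))) (∈-map⁺ (degree G) (∈-allFin v))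

complete : (G : Graph n) → ∀ {k} → n ≡ k → (let open Graph G in ∀ u w → u ≢ w → u ~ w) → G ≅ K k
complete G refl adjacent = record
  { bijection   = ↔-id _
  ; preserves-~ = λ u w → mk⇔ (λ u~w u≡w → ~-irr G u≡w u~w) (adjacent u w)
  }

-- If the clique missed a vertex `v`, a colouring of the other vertices would give its `k + 1`
-- members distinct colours out of `k`. So it contains every vertex.
critical-clique : (G : Graph n) → ∀ {k} → χ G ≡ suc k →
  (∀ v → ∃ λ (c : Fin n → Fin k) → Colourings.ProperOn G (_≢ v) c) → HasClique G (suc k) → G ≅ K (χ G)
critical-clique {n} G {k} χ≡ colourings (S , isClique , size) =
  complete G (sym (trans χ≡ (trans (sym size) n≡))) λ u w → isClique u w (everywhere u) (everywhere w)
  where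
  everywhere : ∀ v → v ∈ S
  everywhere v = decidable-stable (v ∈? S) λ v∉ →
    let c , proper = colourings v
        ≢v : ∀ {u} → u ∈ S → u ≢ v
        ≢v = λ { u∈ refl → v∉ u∈ }
    in <⇒≱ (s≤s ≤-refl) (subst (_≤ k) (trans (#-∈ S) size) (#-injective (_∈? S) c λ {u} {w} u∈ w∈ e →
      decidable-stable (u ≟ᶠ w) λ u≢w → proper u w (≢v u∈) (≢v w∈) (isClique u w u∈ w∈ u≢w) e))
  n≡ : ∣ S ∣ ≡ n
  n≡ = trans (cong ∣_∣ (⊆-antisym ⊆⊤ (λ {v} _ → everywhere v))) (∣⊤∣≡n n)

-- The numbers for maximum degree `k + 1`: the sides get `h` and `k ∸ h` colours, and high cliques
-- have at most `h ∸ 2` vertices. Everything follows from `3 ≤ h` and `h + h ≤ suc k`.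
half-split : ∀ k → 6 ≤ suc k → let h = ⌊ suc k /2⌋ in
             3 ≤ h × h + (k ∸ h) ≡ k × h ∸ 2 < k ∸ h × 2 ≤ k ∸ h × 3 + ((h ∸ 2) + (h ∸ 2)) ≤ k
half-split k 6≤ = 3≤h , m+[n∸m]≡n h≤k , <-≤-trans (bound h 3≤h) h∸1≤ , ≤-trans (∸-monoˡ-≤ 1 3≤h) h∸1≤ , s≤s⁻¹ (≤-trans (triple h 3≤h) 2h≤)
  where
  h : ℕ
  h = ⌊ suc k /2⌋
  3≤h : 3 ≤ h
  3≤h = ⌊n/2⌋-mono 6≤
  2h≤ : h + h ≤ suc k
  2h≤ = ≤-trans (+-monoʳ-≤ h (⌊n/2⌋≤⌈n/2⌉ (suc k))) (≤-reflexive (⌊n/2⌋+⌈n/2⌉≡n (suc k)))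
  bound : ∀ h → 3 ≤ h → h ∸ 2 < h ∸ 1
  bound (suc (suc h)) _ = n<1+n h
  bound (suc zero) (s≤s ())
  triple : ∀ h → 3 ≤ h → 4 + ((h ∸ 2) + (h ∸ 2)) ≤ h + h
  triple (suc (suc h)) _ = ≤-reflexive (cong (2 +_) (trans (cong suc (sym (+-suc h h))) (sym (+-suc h (suc h)))))
  triple (suc zero) (s≤s ())
  h≤k : h ≤ k
  h≤k = s≤s⁻¹ (≤-trans (+-monoˡ-≤ h (≤-trans (s≤s z≤n) 3≤h)) 2h≤)
  h∸1≤ : h ∸ 1 ≤ k ∸ h
  h∸1≤ = subst (_≤ k ∸ h) (m+n∸n≡m (h ∸ 1) h) (∸-monoˡ-≤ h (≤-trans (∸-monoˡ-≤ 1 2h≤′) ≤-refl))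
    where
    2h≤′ : suc ((h ∸ 1) + h) ≤ suc k
    2h≤′ = ≤-trans (≤-reflexive (cong (_+ h) (m+[n∸m]≡n (≤-trans (s≤s z≤n) 3≤h)))) 2h≤

theoremM : ∀ {n : ℕ} (G : Graph n) →
    Critical G →
    Δ G ≤ χ G →
    6 ≤ Δ G →
    ω (ℋ G) ≤ ⌊ Δ G /2⌋ ∸ 2 →
    G ≅ K (χ G)
theoremM {zero} G critical Δ≤χ () ω≤
theoremM {suc n} G critical Δ≤χ 6≤Δ ω≤ = by-χ (χ G) refl
  where
  by-χ : ∀ m → χ G ≡ m → G ≅ K (χ G)
  by-χ zero e = contradiction (≤-trans 6≤Δ (≤-trans Δ≤χ (≤-reflexive e))) λ ()
  by-χ (suc zero) e = contradiction (≤-trans 6≤Δ (≤-trans Δ≤χ (≤-reflexive e))) λ { (s≤s ()) }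
  by-χ (suc (suc k′)) e = critical-clique G e colourings (by-Δ (m≤n⇒m<n∨m≡n (≤-trans Δ≤χ (≤-reflexive e))))
    where
    k : ℕ
    k = suc k′
    6≤k+1 : 6 ≤ suc k
    6≤k+1 = ≤-trans 6≤Δ (≤-trans Δ≤χ (≤-reflexive e))
    ¬col : ¬ Colourable G k
    ¬col col = <⇒≱ (≤-reflexive (sym e)) (χ-minimal G col)
    colourings : ∀ v → ∃ λ (c : Fin (suc n) → Fin k) → Colourings.ProperOn G (_≢ v) c
    colourings v = lift-colouring G (λ w → ¬? (w ≟ᶠ v)) (s≤s⁻¹ (≤-trans (critical v) (≤-reflexive e))) (χ-colourable (G - v))
    -- With χ = `k + 1`, the first case has all degrees at most `k` and is Brooks' theorem; the
    -- second has maximum degree `k + 1`.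
    by-Δ : Δ G < suc k ⊎ Δ G ≡ suc k → HasClique G (suc k)
    by-Δ (inj₁ Δ<) = brooks G k (≤-trans (s≤s (s≤s (s≤s z≤n))) (s≤s⁻¹ 6≤k+1))
      (λ v → ≤-trans (degree≤Δ G v) (s≤s⁻¹ Δ<)) ¬col
    by-Δ (inj₂ Δ≡) = subst (HasClique G ∘ suc) sum≡ (SmallHighCliques.high-cliques-brooks G r (h ∸ 2)
        (¬col ∘ subst (Colourable G) sum≡)
        (λ v → ≤-trans (degree≤Δ G v) (≤-reflexive (trans Δ≡ (cong suc (sym sum≡)))))
        high-clique 2≤r t<r (≤-trans 3+2t≤ (≤-reflexive (sym sum≡))) zero (proj₁ lifted) (proj₂ lifted))
      where
      h : ℕ
      h = ⌊ suc k /2⌋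
      r : Bool → ℕ
      r s = if s then k ∸ h else h
      split : 3 ≤ h × h + (k ∸ h) ≡ k × h ∸ 2 < k ∸ h × 2 ≤ k ∸ h × 3 + ((h ∸ 2) + (h ∸ 2)) ≤ k
      split = half-split k 6≤k+1
      sum≡ : r false + r true ≡ k
      sum≡ = proj₁ (proj₂ split)
      lifted : ∃ λ (c : Fin (suc n) → Fin (r false + r true)) → Colourings.ProperOn G (_≢ zero) c
      lifted = subst (λ j → ∃ λ (c : Fin (suc n) → Fin j) → Colourings.ProperOn G (_≢ zero) c) (sym sum≡) (colourings zero)
      3+2t≤ : 3 + ((h ∸ 2) + (h ∸ 2)) ≤ k
      3+2t≤ = proj₂ (proj₂ (proj₂ (proj₂ split)))
      2≤r : ∀ s → 2 ≤ r s
      2≤r false = <⇒≤ (proj₁ split)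
      2≤r true  = proj₁ (proj₂ (proj₂ (proj₂ split)))
      t<r : ∀ s → h ∸ 2 < r s
      t<r false = ∸-monoʳ-< (s≤s z≤n) (<⇒≤ (proj₁ split))
      t<r true  = proj₁ (proj₂ (proj₂ split))
      high-clique : ∀ {P : Pred (Fin (suc n)) 0ℓ} (P? : Decidable P) →
        (let open Graph G in ∀ u w → P u → P w → u ≢ w → u ~ w) →
        (∀ u → P u → r false + r true < degree G u) → # P? ≤ h ∸ 2
      high-clique P? adjacent high = ≤-trans
        -- A degree above `k` is a degree of at least χ, so a clique of high vertices lies in `ℋ G`.
        (ω-maximal (ℋ G) (induced-clique G (λ v → χ G ≤? degree G v) P?
          (λ u Pu → ≤-trans (≤-reflexive (trans e (cong suc (sym sum≡)))) (high u Pu)) adjacent))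
        (≤-trans ω≤ (≤-reflexive (cong (λ m → ⌊ m /2⌋ ∸ 2) Δ≡)))
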